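{- For every integer $n\ge0$, $\overline{S_3^2}(2n+1)=2\,\overline{S_3}(4n+2)$.
   Context: For $|q|<1$ and a positive integer $k$, write $f_k=\prod_{j\ge1}(1-q^{kj})$. For a positive integer $r$, $\overline{S_3^r}(n)$ (number of $3$-Schur overpartitions of $n$ with $r$-tuples) is defined by $\sum_{n\ge0}\overline{S_3^r}(n)q^n=\prod_{n\ge1}\frac{(1+q^{2n-1})^r(1-q^{3(2n-1)})^r}{(1+q^{3(2n-1)})^r(1-q^{2n-1})^r}=\frac{f_2^{3r}f_3^{2r}f_{12}^r}{f_1^{2r}f_4^rf_6^{3r}}$, and $\overline{S_3}(n)=\overline{S_3^1}(n)$. -}

module Defs where

open import Data.Nat as ℕ using (ℕ; zero; suc; _∸_)
open import Data.Nat.DivMod using (_/_)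
open import Data.Nat.Divisibility using (_∣?_)
open import Data.Integer as ℤ using (ℤ; +_; -_)
open import Relation.Nullary using (yes; no)
open import Relation.Nullary.Decidable using (⌊_⌋)
open import Data.Bool using (if_then_else_)

-- Formal power series in q with integer coefficients: n ↦ [q^n].
Series : Set
Series = ℕ → ℤ

one : Series
one zero    = + 1
one (suc _) = + 0

sumTo : ℕ → (ℕ → ℤ) → ℤ
sumTo zero    h = h zero
sumTo (suc n) h = sumTo n h ℤ.+ h (suc n)

_⊛_ : Series → Series → Series
(f ⊛ g) n = sumTo n (λ k → f k ℤ.* g (n ∸ k))

infixl 7 _⊛_

pow : Series → ℕ → Series
pow f zero    = one
pow f (suc r) = f ⊛ pow f r

-- 1 + c q^m   (m ≥ 1 in all uses)
binom : ℤ → ℕ → Series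
binom c m n with n ℕ.≟ 0 | n ℕ.≟ m
... | yes _ | _     = + 1
... | no _  | yes _ = c
... | no _  | no _  = + 0

-- 1 / (1 - c q^m) = Σ_k c^k q^{mk}   (m ≥ 1 in all uses)
geom : ℤ → ℕ → Series
geom c zero    n = one n
geom c (suc k) n with suc k ∣? n
... | yes _ = c ℤ.^ (n / suc k)
... | no _  = + 0

factor : ℕ → Series
factor m = binom (+ 1) m ⊛ binom (- + 1) (3 ℕ.* m)
         ⊛ geom (- + 1) (3 ℕ.* m) ⊛ geom (+ 1) m

prodTo : ℕ → ℕ → Series
prodTo r zero    = one
prodTo r (suc J) = prodTo r J ⊛ pow (factor (2 ℕ.* J ℕ.+ 1)) r

-- Generating function Σ S̄₃^r(n) q^n = ∏_{j≥1} factor(2j-1)^r.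
-- The coefficient of q^n of the infinite product equals that of the
-- finite product over j ≤ n+1, since factors with 2j-1 > n are ≡ 1 mod q^{n+1}.
S3bar^ : ℕ → ℕ → ℤ
S3bar^ r n = prodTo r (suc n) n

S3bar : ℕ → ℤ
S3bar = S3bar^ 1

{-# OPTIONS --safe #-}
module Submission where

-- Write B_k = ∏ (1 + q^{k(2j-1)}) / (1 - q^{k(2j-1)}), u = B_1, v = B_3, so that the generating
-- function is S = u/v, and let E = u v.  Replacing q by -q inverts u and v.  Gauss's product
-- Σ (-1)^s q^{k s²} = ∏ (1 - q^{ki}) / (1 + q^{ki}) gives φ(-q^{2k}) = B_k φ(-q^k) and
-- φ(q^k) = B_k² φ(-q^k), so identities between binary theta series become algebraic relations
-- between u, v, u' = u(q²), v' = v(q²).  The square lattice gives u⁴ + 1 = 2 u'⁴ u² (likewise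
-- for v), and the hexagonal lattice gives u² + v² = 2 u v u' v'.  The latter says
-- S + 1/S = 2 E(q²).  Eliminating u' and v' yields, up to a sign fixed by the leading
-- coefficients, u⁴ - v⁴ = 2 u v (u² v² - 1), that is S² - 1/S² = 2 (E - 1/E).  Comparing
-- coefficients, [q^{2m}] S = [q^m] E, and [q^m] S² = 2 [q^m] E for odd m.

open import Defs
open import Algebra.Bundles using (CommutativeRing)
open import Algebra.Solver.Ring.AlmostCommutativeRing using (fromCommutativeRing; _-Raw-AlmostCommutative⟶_)
import Algebra.Solver.Ring
open import Data.Integer as ℤ using (ℤ; +_; -[1+_]; -_; ∣_∣) renaming (_*_ to _*ℤ_; _+_ to _+ℤ_; _-_ to _-ℤ_)
import Data.Integer.Properties as ℤₚ
open import Data.Integer.Tactic.RingSolver using () renaming (solve-∀ to ℤ-solve-∀)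
open import Algebra.Properties.AbelianGroup ℤₚ.+-0-abelianGroup using () renaming (∙-cancelʳ to +-cancelʳ)
open import Data.List.Base using (List; []; _∷_; _++_; map; filter; cartesianProduct)
open import Data.List.Membership.Propositional using (_∈_)
open import Data.List.Membership.Propositional.Properties
  using (∈-map⁺; ∈-map⁻; ∈-filter⁺; ∈-filter⁻; ∈-cartesianProduct⁺)
open import Data.List.Membership.Propositional.Properties.WithK using (unique∧set⇒bag)
open import Data.List.Relation.Binary.BagAndSetEquality using (∼bag⇒↭)
open import Data.List.Relation.Binary.Permutation.Propositional as Perm using (_↭_)
open import Data.List.Relation.Unary.All as All using ([]; _∷_)
open import Data.List.Relation.Unary.AllPairs using ([]; _∷_)
open import Data.List.Relation.Unary.Any using (here; there)
open import Data.List.Relation.Unary.Unique.Propositional using (Unique)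
import Data.List.Relation.Unary.Unique.Propositional.Properties as Uniqueₚ
open import Data.Maybe.Base using (Maybe; just; nothing)
open import Data.Nat as ℕ using (ℕ; zero; suc; _+_; _*_; _∸_; _≤_; _<_; z≤n; s≤s; NonZero)
open import Data.Nat.DivMod using (_/_; m/n≡1+[m∸n]/n)
open import Data.Nat.Divisibility using (_∣?_; _∣0; ∣m+n∣m⇒∣n; ∣m∣n⇒∣m+n; ∣-refl; >⇒∤)
open import Data.Nat.Induction using (<-rec)
import Data.Nat.Properties as ℕₚ
import Data.Nat.Tactic.RingSolver as ℕ-Solver
open import Data.Product using (_×_; _,_; proj₁; proj₂; ∃)
open import Data.Product.Properties using (,-injective)
open import Data.Sum using (_⊎_; inj₁; inj₂)
open import Function using (_∘_)
open import Function.Bundles using (mk⇔)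
open import Level using (0ℓ)
open import Relation.Binary.PropositionalEquality
  using (_≡_; _≢_; refl; sym; trans; cong; cong₂; subst; module ≡-Reasoning)
import Relation.Binary.Reasoning.Setoid as SetoidReasoning
open import Relation.Nullary using (yes; no; ¬?; contradiction)

open ≡-Reasoning using (step-≡-⟩; step-≡-⟨) renaming (begin_ to begin≡_; _∎ to _∎≡)

-- The products and theta series are infinite, so each enters as a truncation, and identities
-- between them are equalities modulo q^(N+1). Where a quotient is wanted, an explicit inverse
-- stands in: `neg u` and `neg v` for 1/u and 1/v, and Gauss's product for the reciprocal of
-- φ(-q^k). The algebra thus stays in a commutative ring and is left to the ring solver. The
-- elimination works with s = u u' and t = v v': the mixed equation is u² + v² = 2 s t, and the
-- quadratic ones, multiplied by u² and v², have right sides 2 s⁴ and 2 t⁴. Comparing fourth powers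
-- removes s t, but yields only a vanishing product of two conjugate factors. Modulo q^(N+1) there
-- are zero divisors, so the unwanted factor is cancelled through its leading term 16 q, at the cost
-- of one power of q. Parity closes the argument: q ↦ -q sends S to 1/S and E to 1/E, so the sums
-- and differences in the two final identities isolate the even coefficients of S and the odd ones
-- of S² and E.

sumTo-cong : ∀ n {f g} → (∀ {k} → k ≤ n → f k ≡ g k) → sumTo n f ≡ sumTo n g
sumTo-cong zero    f≡g = f≡g z≤n
sumTo-cong (suc n) f≡g =
  cong₂ _+ℤ_ (sumTo-cong n (λ k≤n → f≡g (ℕₚ.m≤n⇒m≤1+n k≤n))) (f≡g ℕₚ.≤-refl)

sumTo-zero : ∀ n {f} → (∀ {k} → k ≤ n → f k ≡ + 0) → sumTo n f ≡ + 0
sumTo-zero zero    f≡0 = f≡0 z≤n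
sumTo-zero (suc n) f≡0 =
  cong₂ _+ℤ_ (sumTo-zero n (λ k≤n → f≡0 (ℕₚ.m≤n⇒m≤1+n k≤n))) (f≡0 ℕₚ.≤-refl)

sumTo-split₀ : ∀ n f → sumTo (suc n) f ≡ f 0 +ℤ sumTo n (f ∘ suc)
sumTo-split₀ zero    f = refl
sumTo-split₀ (suc n) f = trans (cong (_+ℤ f (suc (suc n))) (sumTo-split₀ n f))
                               (ℤₚ.+-assoc (f 0) _ _)

sumTo-single : ∀ n d {f} → d ≤ n → (∀ {k} → k ≤ n → k ≢ d → f k ≡ + 0) → sumTo n f ≡ f d
sumTo-single zero zero z≤n f≡0 = refl
sumTo-single (suc n) d {f} d≤n f≡0 with d ℕ.≟ suc n
... | yes refl = trans (cong (_+ℤ f (suc n)) (sumTo-zero n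
                   (λ k≤n → f≡0 (ℕₚ.m≤n⇒m≤1+n k≤n) (ℕₚ.<⇒≢ (s≤s k≤n)))))
                   (ℤₚ.+-identityˡ _)
... | no d≢ = trans (cong₂ _+ℤ_ (sumTo-single n d (ℕₚ.≤-pred (ℕₚ.≤∧≢⇒< d≤n d≢))
                       (λ k≤n → f≡0 (ℕₚ.m≤n⇒m≤1+n k≤n)))
                     (f≡0 ℕₚ.≤-refl (d≢ ∘ sym)))
                (ℤₚ.+-identityʳ _)

-- The ring of power series modulo q^(N+1)

infixl 7 _·_
infixl 6 _⊕_
infix  8 ⊖_
infix  4 _≈[_]_

const : ℤ → Series
const c zero    = c
const c (suc _) = + 0

tail : Series → Series
tail f n = f (suc n)

-- Congruence modulo q^(N+1).
record _≈[_]_ (f : Series) (N : ℕ) (g : Series) : Set where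
  constructor coeffs
  field
    at : ∀ {n} → n ≤ N → f n ≡ g n
open _≈[_]_ public

exactly : ∀ {N f g} → (∀ n → f n ≡ g n) → f ≈[ N ] g
exactly f≡g .at {n} _ = f≡g n

≈-weaken : ∀ {M N f g} → M ≤ N → f ≈[ N ] g → f ≈[ M ] g
≈-weaken M≤N f≈g .at n≤M = f≈g .at (ℕₚ.≤-trans n≤M M≤N)

-- Keeping the operations opaque lets their operands be inferred by unification.
opaque
  _⊕_ : Series → Series → Series
  (f ⊕ g) n = f n +ℤ g n

  ⊖_ : Series → Series
  (⊖ f) n = - f n

  ⊕-coeff : ∀ f g n → (f ⊕ g) n ≡ f n +ℤ g n
  ⊕-coeff f g n = refl

  ⊖-coeff : ∀ f n → (⊖ f) n ≡ - f n
  ⊖-coeff f n = refl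

  _·_ : Series → Series → Series
  _·_ = _⊛_

  ·-coeff : ∀ f g n → (f · g) n ≡ (f ⊛ g) n
  ·-coeff f g n = refl

  ·-zero : ∀ f g → (f · g) 0 ≡ f 0 *ℤ g 0
  ·-zero f g = refl

  ·-suc : ∀ f g n → (f · g) (suc n) ≡ f 0 *ℤ g (suc n) +ℤ (tail f · g) n
  ·-suc f g n = sumTo-split₀ n (λ k → f k *ℤ g (suc n ∸ k))

  ·-sucʳ : ∀ f g n → (f · g) (suc n) ≡ (f · tail g) n +ℤ f (suc n) *ℤ g 0
  ·-sucʳ f g n = cong₂ _+ℤ_
    (sumTo-cong n (λ {k} k≤n → cong (λ m → f k *ℤ g m) (ℕₚ.+-∸-assoc 1 k≤n)))
    (cong (λ m → f (suc n) *ℤ g m) (ℕₚ.n∸n≡0 n))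

  ·-cong : ∀ {N f f′ g g′} → f ≈[ N ] f′ → g ≈[ N ] g′ → f · g ≈[ N ] f′ · g′
  ·-cong f≈ g≈ .at {n} n≤N = sumTo-cong n λ {k} k≤n →
    cong₂ _*ℤ_ (f≈ .at (ℕₚ.≤-trans k≤n n≤N)) (g≈ .at (ℕₚ.≤-trans (ℕₚ.m∸n≤m n k) n≤N))

-- Splitting off the first summand of one product and the last summand of the other leaves the same
-- claim for `tail f` and `g`.
·-comm-coeff : ∀ f g n → (f · g) n ≡ (g · f) n
·-comm-coeff f g zero    =
  trans (·-zero f g) (trans (ℤₚ.*-comm (f 0) (g 0)) (sym (·-zero g f)))
·-comm-coeff f g (suc n) = begin≡
  (f · g) (suc n)                        ≡⟨ ·-suc f g n ⟩
  f 0 *ℤ g (suc n) +ℤ (tail f · g) n    ≡⟨ cong₂ _+ℤ_ (ℤₚ.*-comm (f 0) _) (·-comm-coeff (tail f) g n) ⟩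
  g (suc n) *ℤ f 0 +ℤ (g · tail f) n    ≡⟨ ℤₚ.+-comm (g (suc n) *ℤ f 0) _ ⟩
  (g · tail f) n +ℤ g (suc n) *ℤ f 0    ≡⟨ ·-sucʳ g f n ⟨
  (g · f) (suc n)                        ∎≡

opaque
  unfolding _⊕_ _·_

  ·-distribʳ-coeff : ∀ h f g n → ((f ⊕ g) · h) n ≡ (f · h ⊕ g · h) n
  ·-distribʳ-coeff h f g zero    = trans (·-zero (f ⊕ g) h)
    (trans (ℤₚ.*-distribʳ-+ (h 0) (f 0) (g 0)) (sym (cong₂ _+ℤ_ (·-zero f h) (·-zero g h))))
  ·-distribʳ-coeff h f g (suc n) = begin≡
    ((f ⊕ g) · h) (suc n)
      ≡⟨ ·-suc (f ⊕ g) h n ⟩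
    (f 0 +ℤ g 0) *ℤ h (suc n) +ℤ ((tail f ⊕ tail g) · h) n
      ≡⟨ cong ((f 0 +ℤ g 0) *ℤ h (suc n) +ℤ_) (·-distribʳ-coeff h (tail f) (tail g) n) ⟩
    (f 0 +ℤ g 0) *ℤ h (suc n) +ℤ ((tail f · h) n +ℤ (tail g · h) n)
      ≡⟨ rearrange (f 0) (g 0) (h (suc n)) _ _ ⟩
    f 0 *ℤ h (suc n) +ℤ (tail f · h) n +ℤ (g 0 *ℤ h (suc n) +ℤ (tail g · h) n)
      ≡⟨ cong₂ _+ℤ_ (·-suc f h n) (·-suc g h n) ⟨
    (f · h ⊕ g · h) (suc n) ∎≡
    where
    rearrange : ∀ a b c x y → (a +ℤ b) *ℤ c +ℤ (x +ℤ y) ≡ a *ℤ c +ℤ x +ℤ (b *ℤ c +ℤ y)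
    rearrange = ℤ-solve-∀

const-· : ∀ c f n → (const c · f) n ≡ c *ℤ f n
const-· c f n = trans (·-coeff (const c) f n) (sumTo-single n 0 z≤n vanish)
  where
  vanish : ∀ {k} → k ≤ n → k ≢ 0 → const c k *ℤ f (n ∸ k) ≡ + 0
  vanish {zero}  _ 0≢0 = contradiction refl 0≢0
  vanish {suc k} _ _   = refl

scale-· : ∀ c f g n → ((λ k → c *ℤ f k) · g) n ≡ c *ℤ (f · g) n
scale-· c f g zero    = trans (·-zero (λ k → c *ℤ f k) g)
  (trans (ℤₚ.*-assoc c (f 0) (g 0)) (cong (c *ℤ_) (sym (·-zero f g))))
scale-· c f g (suc n) = begin≡
  ((λ k → c *ℤ f k) · g) (suc n)
    ≡⟨ ·-suc (λ k → c *ℤ f k) g n ⟩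
  c *ℤ f 0 *ℤ g (suc n) +ℤ ((λ k → c *ℤ tail f k) · g) n
    ≡⟨ cong₂ _+ℤ_ (ℤₚ.*-assoc c (f 0) _) (scale-· c (tail f) g n) ⟩
  c *ℤ (f 0 *ℤ g (suc n)) +ℤ c *ℤ (tail f · g) n
    ≡⟨ ℤₚ.*-distribˡ-+ c _ _ ⟨
  c *ℤ (f 0 *ℤ g (suc n) +ℤ (tail f · g) n)
    ≡⟨ cong (c *ℤ_) (·-suc f g n) ⟨
  c *ℤ (f · g) (suc n) ∎≡

opaque
  unfolding _⊕_ _·_

  ·-tail : ∀ {N} f g → tail (f · g) ≈[ N ] (λ k → f 0 *ℤ tail g k) ⊕ tail f · g
  ·-tail f g = exactly (·-suc f g)

  -- Induction on `n`: by `·-tail`, the next coefficient reduces to distributivity, scaling and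
  -- associativity for `tail f`.
  ·-assoc-coeff : ∀ f g h n → (f · g · h) n ≡ (f · (g · h)) n
  ·-assoc-coeff f g h zero    = begin≡
    (f · g · h) 0          ≡⟨ ·-zero (f · g) h ⟩
    (f · g) 0 *ℤ h 0       ≡⟨ cong (_*ℤ h 0) (·-zero f g) ⟩
    f 0 *ℤ g 0 *ℤ h 0      ≡⟨ ℤₚ.*-assoc (f 0) (g 0) (h 0) ⟩
    f 0 *ℤ (g 0 *ℤ h 0)    ≡⟨ cong (f 0 *ℤ_) (·-zero g h) ⟨
    f 0 *ℤ (g · h) 0       ≡⟨ ·-zero f (g · h) ⟨
    (f · (g · h)) 0        ∎≡
  ·-assoc-coeff f g h (suc n) = begin≡
    (f · g · h) (suc n)
      ≡⟨ trans (·-suc (f · g) h n) (cong (λ x → x *ℤ h (suc n) +ℤ (tail (f · g) · h) n) (·-zero f g)) ⟩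
    f 0 *ℤ g 0 *ℤ h (suc n) +ℤ (tail (f · g) · h) n
      ≡⟨ cong (f 0 *ℤ g 0 *ℤ h (suc n) +ℤ_)
           (·-cong {g = h} (·-tail f g) (exactly λ _ → refl) .at (ℕₚ.≤-refl {n})) ⟩
    f 0 *ℤ g 0 *ℤ h (suc n) +ℤ (((λ k → f 0 *ℤ tail g k) ⊕ tail f · g) · h) n
      ≡⟨ cong (f 0 *ℤ g 0 *ℤ h (suc n) +ℤ_)
           (·-distribʳ-coeff h (λ k → f 0 *ℤ tail g k) (tail f · g) n) ⟩
    f 0 *ℤ g 0 *ℤ h (suc n) +ℤ (((λ k → f 0 *ℤ tail g k) · h) n +ℤ (tail f · g · h) n)
      ≡⟨ cong₂ (λ x y → f 0 *ℤ g 0 *ℤ h (suc n) +ℤ (x +ℤ y))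
           (scale-· (f 0) (tail g) h n) (·-assoc-coeff (tail f) g h n) ⟩
    f 0 *ℤ g 0 *ℤ h (suc n) +ℤ (f 0 *ℤ (tail g · h) n +ℤ (tail f · (g · h)) n)
      ≡⟨ rearrange (f 0) (g 0) (h (suc n)) _ _ ⟩
    f 0 *ℤ (g 0 *ℤ h (suc n) +ℤ (tail g · h) n) +ℤ (tail f · (g · h)) n
      ≡⟨ cong (λ x → f 0 *ℤ x +ℤ (tail f · (g · h)) n) (·-suc g h n) ⟨
    f 0 *ℤ (g · h) (suc n) +ℤ (tail f · (g · h)) n
      ≡⟨ ·-suc f (g · h) n ⟨
    (f · (g · h)) (suc n) ∎≡
    where
    rearrange : ∀ a b c x y → a *ℤ b *ℤ c +ℤ (a *ℤ x +ℤ y) ≡ a *ℤ (b *ℤ c +ℤ x) +ℤ y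
    rearrange = ℤ-solve-∀

const-identity : ∀ f n → (const (+ 1) · f) n ≡ f n
const-identity f n = trans (const-· (+ 1) f n) (ℤₚ.*-identityˡ (f n))

const-0 : ∀ n → const (+ 0) n ≡ + 0
const-0 zero    = refl
const-0 (suc _) = refl

opaque
  unfolding _⊕_

  ⊕-congruent : ∀ {N f f′ g g′} → f ≈[ N ] f′ → g ≈[ N ] g′ → f ⊕ g ≈[ N ] f′ ⊕ g′
  ⊕-congruent f≈ g≈ .at n≤N = cong₂ _+ℤ_ (f≈ .at n≤N) (g≈ .at n≤N)

  ⊖-congruent : ∀ {N f f′} → f ≈[ N ] f′ → ⊖ f ≈[ N ] ⊖ f′
  ⊖-congruent f≈ .at n≤N = cong -_ (f≈ .at n≤N)

  ⊕-associative : ∀ {N} f g h → f ⊕ g ⊕ h ≈[ N ] f ⊕ (g ⊕ h)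
  ⊕-associative f g h = exactly λ n → ℤₚ.+-assoc (f n) (g n) (h n)

  ⊕-commutative : ∀ {N} f g → f ⊕ g ≈[ N ] g ⊕ f
  ⊕-commutative f g = exactly λ n → ℤₚ.+-comm (f n) (g n)

  ⊕-zeroˡ : ∀ {N} f → const (+ 0) ⊕ f ≈[ N ] f
  ⊕-zeroˡ f = exactly λ n → trans (cong (_+ℤ f n) (const-0 n)) (ℤₚ.+-identityˡ (f n))

  ⊕-zeroʳ : ∀ {N} f → f ⊕ const (+ 0) ≈[ N ] f
  ⊕-zeroʳ f = exactly λ n → trans (cong (f n +ℤ_) (const-0 n)) (ℤₚ.+-identityʳ (f n))

  ⊖-inverseˡ : ∀ {N} f → ⊖ f ⊕ f ≈[ N ] const (+ 0)
  ⊖-inverseˡ f = exactly λ n → trans (ℤₚ.+-inverseˡ (f n)) (sym (const-0 n))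

  ⊖-inverseʳ : ∀ {N} f → f ⊕ ⊖ f ≈[ N ] const (+ 0)
  ⊖-inverseʳ f = exactly λ n → trans (ℤₚ.+-inverseʳ (f n)) (sym (const-0 n))

  ·-distributesˡ : ∀ {N} h f g → h · (f ⊕ g) ≈[ N ] h · f ⊕ h · g
  ·-distributesˡ h f g = exactly λ n →
    trans (·-comm-coeff h (f ⊕ g) n)
    (trans (·-distribʳ-coeff h f g n)
      (cong₂ _+ℤ_ (·-comm-coeff f h n) (·-comm-coeff g h n)))

  const-+ : ∀ {N} a b → const (a +ℤ b) ≈[ N ] const a ⊕ const b
  const-+ a b = exactly λ where
    zero    → refl
    (suc n) → refl

  const-neg : ∀ {N} a → const (- a) ≈[ N ] ⊖ const a
  const-neg a = exactly λ where
    zero    → refl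
    (suc n) → refl

const-* : ∀ {N} a b → const (a *ℤ b) ≈[ N ] const a · const b
const-* a b = exactly λ n → sym (trans (const-· a (const b) n) (scale n))
  where
  scale : ∀ n → a *ℤ const b n ≡ const (a *ℤ b) n
  scale zero    = refl
  scale (suc n) = ℤₚ.*-zeroʳ a

-- Carrier and operations are the same for every `N`; only the equality changes. A lemma that holds
-- for all `N` is an exact identity, while one about truncations records the order to which it is
-- valid.
seriesRing : ℕ → CommutativeRing 0ℓ 0ℓ
seriesRing N = record
  { Carrier = Series
  ; _≈_ = _≈[ N ]_
  ; _+_ = _⊕_
  ; _*_ = _·_
  ; -_  = ⊖_
  ; 0#  = const (+ 0)
  ; 1#  = const (+ 1)
  ; isCommutativeRing = record
    { isRing = record
      { +-isAbelianGroup = record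
        { isGroup = record
          { isMonoid = record
            { isSemigroup = record
              { isMagma = record
                { isEquivalence = record
                  { refl  = exactly λ _ → refl
                  ; sym   = λ f≈g → coeffs λ n≤N → sym (f≈g .at n≤N)
                  ; trans = λ f≈g g≈h → coeffs λ n≤N → trans (f≈g .at n≤N) (g≈h .at n≤N)
                  }
                ; ∙-cong = ⊕-congruent
                }
              ; assoc = ⊕-associative
              }
            ; identity = ⊕-zeroˡ , ⊕-zeroʳ
            }
          ; inverse = ⊖-inverseˡ , ⊖-inverseʳ
          ; ⁻¹-cong = ⊖-congruent
          }
        ; comm = ⊕-commutative
        }
      ; *-cong = ·-cong
      ; *-assoc = λ f g h → exactly (·-assoc-coeff f g h)
      ; *-identity = (λ f → exactly (const-identity f))
                   , (λ f → exactly λ n → trans (·-comm-coeff f (const (+ 1)) n) (const-identity f n))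
      ; distrib = ·-distributesˡ , (λ h f g → exactly (·-distribʳ-coeff h f g))
      }
    ; *-comm = λ f g → exactly (·-comm-coeff f g)
    }
  }

open module Ring {N : ℕ} = CommutativeRing (seriesRing N) public
  using () renaming
  ( refl to ≈-refl; sym to ≈-sym; trans to ≈-trans; +-cong to ⊕-cong; -‿cong to ⊖-cong
  ; reflexive to ≈-reflexive; *-assoc to ·-assoc; *-identityˡ to ·-identityˡ
  ; *-identityʳ to ·-identityʳ; distribʳ to ·-distribʳ
  ; distribˡ to ·-distribˡ; zeroˡ to ·-zeroˡ; zeroʳ to ·-zeroʳ
  )

open module ≈-Reasoning {N : ℕ} = SetoidReasoning (CommutativeRing.setoid (seriesRing N))
  using (begin_; step-≈-⟩; step-≈-⟨; _∎)

-- Embeds integers as constant series, so that the solver can collect and cancel numerical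
-- multiples.
const-morphism : ∀ N → ℤ.+-*-rawRing -Raw-AlmostCommutative⟶ fromCommutativeRing (seriesRing N)
const-morphism N = record
  { ⟦_⟧    = const
  ; +-homo = const-+
  ; *-homo = const-*
  ; -‿homo = const-neg
  ; 0-homo = ≈-refl
  ; 1-homo = ≈-refl
  }

const-≟ : ∀ N a b → Maybe (const a ≈[ N ] const b)
const-≟ N a b with a ℤ.≟ b
... | yes refl = just ≈-refl
... | no  _    = nothing

module Solver {N : ℕ} =
  Algebra.Solver.Ring ℤ.+-*-rawRing (fromCommutativeRing (seriesRing N)) (const-morphism N) (const-≟ N)

open Solver using (solve; con; _:+_; _:*_; :-_; _:=_)

-- Monomials

-- The Kronecker delta, by recursion instead of a test `i ≡ n`, so that shifting both arguments by
-- one is definitional.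
mono : ℕ → Series
mono zero    zero    = + 1
mono zero    (suc n) = + 0
mono (suc i) zero    = + 0
mono (suc i) (suc n) = mono i n

mono-0 : ∀ {N} → mono 0 ≈[ N ] const (+ 1)
mono-0 = exactly λ where
  zero    → refl
  (suc n) → refl

mono-supp : ∀ i n → mono i n ≢ + 0 → i ≡ n
mono-supp zero    zero    _ = refl
mono-supp zero    (suc n) ≢0 = contradiction refl ≢0
mono-supp (suc i) zero    ≢0 = contradiction refl ≢0
mono-supp (suc i) (suc n) ≢0 = cong suc (mono-supp i n ≢0)

mono-off : ∀ {i n} → i ≢ n → mono i n ≡ + 0
mono-off {i} {n} i≢n with mono i n ℤ.≟ + 0
... | yes ≡0 = ≡0
... | no  ≢0 = contradiction (mono-supp i n ≢0) i≢n

mono-diag : ∀ i → mono i i ≡ + 1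
mono-diag zero    = refl
mono-diag (suc i) = mono-diag i

mono-high : ∀ {N i} → N < i → mono i ≈[ N ] const (+ 0)
mono-high {i = i} N<i .at {n} n≤N = trans (mono-off {i} {n} λ { refl → ℕₚ.<⇒≱ N<i n≤N }) (sym (const-0 n))

mono-·-suc : ∀ i f n → (mono (suc i) · f) (suc n) ≡ (mono i · f) n
mono-·-suc i f n = trans (·-suc (mono (suc i)) f n) (ℤₚ.+-identityˡ _)

mono-·-shift : ∀ i f n → (mono i · f) (i + n) ≡ f n
mono-·-shift zero    f n = trans (·-cong {g = f} mono-0 ≈-refl .at (ℕₚ.≤-refl {n})) (const-identity f n)
mono-·-shift (suc i) f n = trans (mono-·-suc i f (i + n)) (mono-·-shift i f n)

mono-·-low : ∀ i f {n} → n < i → (mono i · f) n ≡ + 0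
mono-·-low (suc i) f {zero}  _         = ·-zero (mono (suc i)) f
mono-·-low (suc i) f {suc n} (s≤s n<i) = trans (mono-·-suc i f n) (mono-·-low i f n<i)

mono-· : ∀ {N} i j → mono i · mono j ≈[ N ] mono (i + j)
mono-· zero    j = ≈-trans (·-cong mono-0 ≈-refl) (·-identityˡ (mono j))
mono-· (suc i) j = exactly λ where
  zero    → ·-zero (mono (suc i)) (mono j)
  (suc n) → trans (mono-·-suc i (mono j) n) (mono-· i j .at (ℕₚ.≤-refl {n}))

-- The substitutions q ↦ -q and q ↦ q²

sign : ℕ → ℤ
sign zero    = + 1
sign (suc n) = - sign n

sign-+ : ∀ m n → sign (m + n) ≡ sign m *ℤ sign n
sign-+ zero    n = sym (ℤₚ.*-identityˡ _)
sign-+ (suc m) n = trans (cong -_ (sign-+ m n)) (ℤₚ.neg-distribˡ-* (sign m) _)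

sign-sq : ∀ n → sign n *ℤ sign n ≡ + 1
sign-sq zero    = refl
sign-sq (suc n) = trans (neg-sq (sign n)) (sign-sq n)
  where
  neg-sq : ∀ a → - a *ℤ - a ≡ a *ℤ a
  neg-sq = ℤ-solve-∀

neg : Series → Series
neg f n = sign n *ℤ f n

neg-cong : ∀ {N f g} → f ≈[ N ] g → neg f ≈[ N ] neg g
neg-cong f≈g .at {n} n≤N = cong (sign n *ℤ_) (f≈g .at n≤N)

opaque
  unfolding _⊕_

  neg-⊕ : ∀ {N} f g → neg (f ⊕ g) ≈[ N ] neg f ⊕ neg g
  neg-⊕ f g = exactly λ n → ℤₚ.*-distribˡ-+ (sign n) (f n) (g n)

sumTo-scale : ∀ c n f → sumTo n (λ k → c *ℤ f k) ≡ c *ℤ sumTo n f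
sumTo-scale c zero    f = refl
sumTo-scale c (suc n) f = trans (cong (_+ℤ c *ℤ f (suc n)) (sumTo-scale c n f))
                                (sym (ℤₚ.*-distribˡ-+ c _ _))

neg-· : ∀ {N} f g → neg (f · g) ≈[ N ] neg f · neg g
neg-· f g = exactly λ n →
  trans (cong (sign n *ℤ_) (·-coeff f g n))
  (trans (sym (sumTo-scale (sign n) n (λ k → f k *ℤ g (n ∸ k))))
  (trans (sumTo-cong n λ {k} k≤n →
    trans (cong (_*ℤ (f k *ℤ g (n ∸ k))) (sign-split n k k≤n))
          (interchange (sign k) (sign (n ∸ k)) (f k) (g (n ∸ k))))
  (sym (·-coeff (neg f) (neg g) n))))
  where
  sign-split : ∀ n k → k ≤ n → sign n ≡ sign k *ℤ sign (n ∸ k)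
  sign-split n k k≤n = trans (cong sign (sym (ℕₚ.m+[n∸m]≡n k≤n))) (sign-+ k (n ∸ k))
  interchange : ∀ a b c d → a *ℤ b *ℤ (c *ℤ d) ≡ a *ℤ c *ℤ (b *ℤ d)
  interchange = ℤ-solve-∀

neg-const : ∀ {N} c → neg (const c) ≈[ N ] const c
neg-const c = exactly λ where
  zero    → ℤₚ.*-identityˡ c
  (suc n) → ℤₚ.*-zeroʳ (sign (suc n))

neg-involutive : ∀ {N} f → neg (neg f) ≈[ N ] f
neg-involutive f = exactly λ n → trans (sym (ℤₚ.*-assoc (sign n) (sign n) (f n)))
  (trans (cong (_*ℤ f n) (sign-sq n)) (ℤₚ.*-identityˡ (f n)))

neg-mono : ∀ {N} i → neg (mono i) ≈[ N ] const (sign i) · mono i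
neg-mono i = exactly λ n → trans (go n) (sym (const-· (sign i) (mono i) n))
  where
  go : ∀ n → sign n *ℤ mono i n ≡ sign i *ℤ mono i n
  go n with i ℕ.≟ n
  ... | yes refl = refl
  ... | no  i≢n  rewrite mono-off i≢n = trans (ℤₚ.*-zeroʳ (sign n)) (sym (ℤₚ.*-zeroʳ (sign i)))

dil : Series → Series
dil f zero          = f zero
dil f (suc zero)    = + 0
dil f (suc (suc n)) = dil (tail f) n

dil-even : ∀ f n → dil f (n + n) ≡ f n
dil-even f zero    = refl
dil-even f (suc n) rewrite ℕₚ.+-suc n n = dil-even (tail f) n

dil-ext : ∀ n {f g} → (∀ {k} → k ≤ n → f k ≡ g k) → dil f n ≡ dil g n
dil-ext zero          f≡g = f≡g z≤n
dil-ext (suc zero)    f≡g = refl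
dil-ext (suc (suc n)) f≡g = dil-ext n (λ k≤n → f≡g (s≤s (ℕₚ.m≤n⇒m≤1+n k≤n)))

dil-cong : ∀ {N f g} → f ≈[ N ] g → dil f ≈[ N ] dil g
dil-cong f≈g .at {n} n≤N = dil-ext n (λ k≤n → f≈g .at (ℕₚ.≤-trans k≤n n≤N))

opaque
  unfolding _⊕_

  dil-⊕ : ∀ {N} f g → dil (f ⊕ g) ≈[ N ] dil f ⊕ dil g
  dil-⊕ f g = exactly (go f g)
    where
    go : ∀ f g n → dil (f ⊕ g) n ≡ dil f n +ℤ dil g n
    go f g zero          = refl
    go f g (suc zero)    = refl
    go f g (suc (suc n)) = go (tail f) (tail g) n

dil-scale : ∀ c f n → dil (λ k → c *ℤ f k) n ≡ c *ℤ dil f n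
dil-scale c f zero          = refl
dil-scale c f (suc zero)    = sym (ℤₚ.*-zeroʳ c)
dil-scale c f (suc (suc n)) = dil-scale c (tail f) n

-- Peeling two coefficients off `dil f`, its constant term and the zero after it, matches peeling
-- one coefficient off `f`.
dil-· : ∀ {N} f g → dil (f · g) ≈[ N ] dil f · dil g
dil-· f g = exactly (go f g)
  where
  go : ∀ f g n → dil (f · g) n ≡ (dil f · dil g) n
  go f g zero          = trans (·-zero f g) (sym (·-zero (dil f) (dil g)))
  go f g (suc zero)    = sym (trans (·-suc (dil f) (dil g) 0)
    (cong₂ _+ℤ_ (ℤₚ.*-zeroʳ (f 0)) (·-zero (tail (dil f)) (dil g))))
  go f g (suc (suc n)) = begin≡
    dil (tail (f · g)) n
      ≡⟨ dil-cong (·-tail f g) .at (ℕₚ.≤-refl {n}) ⟩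
    dil ((λ k → f 0 *ℤ tail g k) ⊕ tail f · g) n
      ≡⟨ trans (dil-⊕ (λ k → f 0 *ℤ tail g k) (tail f · g) .at (ℕₚ.≤-refl {n}))
           (⊕-coeff (dil (λ k → f 0 *ℤ tail g k)) (dil (tail f · g)) n) ⟩
    dil (λ k → f 0 *ℤ tail g k) n +ℤ dil (tail f · g) n
      ≡⟨ cong₂ _+ℤ_ (dil-scale (f 0) (tail g) n) (go (tail f) g n) ⟩
    f 0 *ℤ dil (tail g) n +ℤ (dil (tail f) · dil g) n
      ≡⟨ cong (f 0 *ℤ dil (tail g) n +ℤ_) (ℤₚ.+-identityˡ _) ⟨
    f 0 *ℤ dil g (suc (suc n)) +ℤ (+ 0 *ℤ dil g (suc n) +ℤ (dil (tail f) · dil g) n)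
      ≡⟨ cong (f 0 *ℤ dil g (suc (suc n)) +ℤ_) (·-suc (tail (dil f)) (dil g) n) ⟨
    f 0 *ℤ dil g (suc (suc n)) +ℤ (tail (dil f) · dil g) (suc n)
      ≡⟨ ·-suc (dil f) (dil g) (suc n) ⟨
    (dil f · dil g) (suc (suc n)) ∎≡

dil-0 : ∀ n → dil (λ _ → + 0) n ≡ + 0
dil-0 zero          = refl
dil-0 (suc zero)    = refl
dil-0 (suc (suc n)) = dil-0 n

dil-const : ∀ {N} c → dil (const c) ≈[ N ] const c
dil-const c = exactly λ where
  zero          → refl
  (suc zero)    → refl
  (suc (suc n)) → dil-0 n

dil-mono : ∀ {N} i → dil (mono i) ≈[ N ] mono (2 * i)
dil-mono {N} i = subst (λ m → dil (mono i) ≈[ N ] mono m)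
  (cong (_+_ i) (sym (ℕₚ.+-identityʳ i))) (exactly (go i))
  where
  go : ∀ i n → dil (mono i) n ≡ mono (i + i) n
  go zero    zero          = refl
  go zero    (suc zero)    = refl
  go zero    (suc (suc n)) = dil-0 n
  go (suc i) zero          = refl
  go (suc i) (suc zero)    rewrite ℕₚ.+-suc i i = refl
  go (suc i) (suc (suc n)) rewrite ℕₚ.+-suc i i = go i n

neg-dil : ∀ {N} f → neg (dil f) ≈[ N ] dil f
neg-dil f = exactly (go f)
  where
  go : ∀ f n → sign n *ℤ dil f n ≡ dil f n
  go f zero          = ℤₚ.*-identityˡ (f 0)
  go f (suc zero)    = refl
  go f (suc (suc n)) = trans (cong (_*ℤ dil (tail f) n) (ℤₚ.neg-involutive (sign n))) (go (tail f) n)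

-- Factors of the product

binom-mono : ∀ {N} c m .{{_ : NonZero m}} → binom c m ≈[ N ] const (+ 1) ⊕ const c · mono m
binom-mono c m@(suc m′) = exactly λ n → trans (go n) (sym
  (trans (⊕-coeff (const (+ 1)) (const c · mono m) n) (cong (const (+ 1) n +ℤ_) (const-· c (mono m) n))))
  where
  go : ∀ n → binom c m n ≡ const (+ 1) n +ℤ c *ℤ mono m n
  go zero = sym (cong (+ 1 +ℤ_) (ℤₚ.*-zeroʳ c))
  go (suc n) with suc n ℕ.≟ m
  ... | yes refl rewrite mono-diag n = sym (trans (ℤₚ.+-identityˡ _) (ℤₚ.*-identityʳ c))
  ... | no  n≢m rewrite mono-off {m′} {n} (λ m′≡n → n≢m (cong suc (sym m′≡n))) =
    sym (trans (ℤₚ.+-identityˡ _) (ℤₚ.*-zeroʳ c))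

geom-step : ∀ c m .{{_ : NonZero m}} n → geom c m (m + n) ≡ c *ℤ geom c m n
geom-step c m@(suc _) n with m ∣? (m + n) | m ∣? n
... | yes _ | yes _ = cong (ℤ._^_ c)
  (trans (m/n≡1+[m∸n]/n (ℕₚ.m≤m+n m n)) (cong (λ k → suc (k / m)) (ℕₚ.m+n∸m≡n m n)))
... | yes m∣m+n | no m∤n = contradiction (∣m+n∣m⇒∣n m∣m+n ∣-refl) m∤n
... | no m∤m+n | yes m∣n = contradiction (∣m∣n⇒∣m+n ∣-refl m∣n) m∤m+n
... | no _ | no _ = sym (ℤₚ.*-zeroʳ c)

geom-low : ∀ c m {n} → n < m → geom c m n ≡ const (+ 1) n
geom-low c m@(suc _) {zero} _ with m ∣? 0
... | yes _ = refl
... | no m∤0 = contradiction (m ∣0) m∤0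
geom-low c m@(suc _) {suc n} n<m with m ∣? suc n
... | yes m∣n = contradiction m∣n (>⇒∤ n<m)
... | no _ = refl

-- Multiplication by c q^m shifts by m places and scales by c, which by `geom-step` reproduces the
-- series from degree m on. Below degree m only the constant term 1 is left.
geom-inverse : ∀ {N} c m .{{_ : NonZero m}} →
               (const (+ 1) ⊕ ⊖ (const c · mono m)) · geom c m ≈[ N ] const (+ 1)
geom-inverse c m = ≈-trans
  (solve 3 (λ c x g → (con (+ 1) :+ :- (c :* x)) :* g := g :+ :- (c :* (x :* g))) ≈-refl
    (const c) (mono m) (geom c m))
  (exactly λ n → trans (⊕-coeff (geom c m) (⊖ (const c · (mono m · geom c m))) n)
    (trans (cong (geom c m n +ℤ_) (trans (⊖-coeff (const c · (mono m · geom c m)) n)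
      (cong -_ (const-· c (mono m · geom c m) n)))) (go n)))
  where
  go : ∀ n → geom c m n +ℤ - (c *ℤ (mono m · geom c m) n) ≡ const (+ 1) n
  go n with n ℕ.<? m
  ... | yes n<m rewrite mono-·-low m (geom c m) n<m | ℤₚ.*-zeroʳ c =
    trans (ℤₚ.+-identityʳ _) (geom-low c m n<m)
  ... | no n≮m with n ∸ m | ℕₚ.m+[n∸m]≡n (ℕₚ.≮⇒≥ n≮m)
  ... | k | refl rewrite mono-·-shift m (geom c m) k | geom-step c m k =
    trans (ℤₚ.+-inverseʳ (c *ℤ geom c m k)) (sym (high m))
    where
    high : ∀ m .{{_ : NonZero m}} → const (+ 1) (m + k) ≡ + 0
    high (suc _) = refl

𝟏 : Series
𝟏 = const (+ 1)

·-congˡ : ∀ {N f g} h → f ≈[ N ] g → h · f ≈[ N ] h · g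
·-congˡ h f≈g = ·-cong ≈-refl f≈g

·-congʳ : ∀ {N f g} h → f ≈[ N ] g → f · h ≈[ N ] g · h
·-congʳ h f≈g = ·-cong f≈g ≈-refl

mono-cong : ∀ {N m n} → m ≡ n → mono m ≈[ N ] mono n
mono-cong refl = ≈-refl

mono-product : ∀ {N} i j {m} → i + j ≡ m → mono m ≈[ N ] mono i · mono j
mono-product i j refl = ≈-sym (mono-· i j)

≈-neg-mono : ∀ {N} m → 𝟏 ⊕ const (- + 1) · mono m ≈[ N ] 𝟏 ⊕ ⊖ mono m
≈-neg-mono m = solve 1 (λ x → con (+ 1) :+ con (- + 1) :* x := con (+ 1) :+ :- x) ≈-refl (mono m)

geom₊-inverse : ∀ {N} m .{{_ : NonZero m}} → (𝟏 ⊕ ⊖ mono m) · geom (+ 1) m ≈[ N ] 𝟏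
geom₊-inverse m = ≈-trans
  (solve 2 (λ x g → (con (+ 1) :+ :- x) :* g := (con (+ 1) :+ :- (con (+ 1) :* x)) :* g) ≈-refl
    (mono m) (geom (+ 1) m))
  (geom-inverse (+ 1) m)

geom₋-inverse : ∀ {N} m .{{_ : NonZero m}} → (𝟏 ⊕ mono m) · geom (- + 1) m ≈[ N ] 𝟏
geom₋-inverse m = ≈-trans
  (solve 2 (λ x g → (con (+ 1) :+ x) :* g := (con (+ 1) :+ :- (con (- + 1) :* x)) :* g) ≈-refl
    (mono m) (geom (- + 1) m))
  (geom-inverse (- + 1) m)

ratio : ℕ → Series
ratio m = (𝟏 ⊕ mono m) · geom (+ 1) m

ratio-spec : ∀ {N} m .{{_ : NonZero m}} → (𝟏 ⊕ ⊖ mono m) · ratio m ≈[ N ] 𝟏 ⊕ mono m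
ratio-spec m = begin
  (𝟏 ⊕ ⊖ x) · ((𝟏 ⊕ x) · g)
    ≈⟨ solve 2 (λ x g → (con (+ 1) :+ :- x) :* ((con (+ 1) :+ x) :* g)
                      := (con (+ 1) :+ x) :* ((con (+ 1) :+ :- x) :* g)) ≈-refl x g ⟩
  (𝟏 ⊕ x) · ((𝟏 ⊕ ⊖ x) · g)  ≈⟨ ·-congˡ (𝟏 ⊕ x) (geom₊-inverse m) ⟩
  (𝟏 ⊕ x) · 𝟏                ≈⟨ ·-identityʳ (𝟏 ⊕ x) ⟩
  𝟏 ⊕ x ∎
  where
  x = mono m
  g = geom (+ 1) m

geom-high : ∀ {N m} c → N < m → geom c m ≈[ N ] 𝟏
geom-high c N<m .at n≤N = geom-low c _ (ℕₚ.≤-<-trans n≤N N<m)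

ratio-high : ∀ {N m} → N < m → ratio m ≈[ N ] 𝟏
ratio-high {N} {m} N<m = begin
  (𝟏 ⊕ mono m) · geom (+ 1) m    ≈⟨ ·-cong (⊕-cong ≈-refl (mono-high N<m)) (geom-high (+ 1) N<m) ⟩
  (𝟏 ⊕ const (+ 0)) · 𝟏          ≈⟨ solve 0 ((con (+ 1) :+ con (+ 0)) :* con (+ 1) := con (+ 1)) ≈-refl ⟩
  𝟏                              ∎

-- Gauss: Σ (-1)^s q^{k s²} = ∏ (1 - q^{ki}) / (1 + q^{ki})

ratios : ℕ → ℕ → Series
ratios k zero    = 𝟏
ratios k (suc n) = ratios k n · ratio (k * suc n)

-- θ ε k n = Σ_{|s| ≤ n} ε(|s|) q^{k s²}
θ : (ℕ → ℤ) → ℕ → ℕ → Series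
θ ε k zero    = const (ε 0)
θ ε k (suc n) = θ ε k n ⊕ (const (ε (suc n)) ⊕ const (ε (suc n))) · mono (k * (suc n * suc n))

module Gauss (k : ℕ) .{{_ : NonZero k}} where

  instance
    _ : ∀ {n} → NonZero (k * suc n)
    _ = ℕₚ.m*n≢0 k _

  -- Following Shanks, the partial theta sum times ∏ (1 + q^{ki}) / (1 - q^{ki}) is
  -- 1 + 2 correction n n exactly, and the correction is O(q^{n+1}).
  correction : ℕ → ℕ → Series
  correction n zero    = const (+ 0)
  correction n (suc m) = correction n m ⊕
    const (sign (suc m)) · ratios k (suc m) · geom (- + 1) (k * suc m) · mono (k * (suc m * suc n))

  -- Put y_i = q^(k i (n+1)), z_i = q^(k i) and R_i = `ratios k i`. Because (1 - x) z_i - (1 + x) =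
  -- -((1 - z_i) + x (1 + z_i)), the i-th summands combine to D_(i-1) - D_i with D_i = (-1)^i R_i
  -- y_(i+1). The total is D_0 - D_m, and D_0 = x.
  telescope : ∀ {N} n m → let x = mono (k * suc n) in
    (𝟏 ⊕ ⊖ x) · correction (suc n) m ⊕ ⊖ ((𝟏 ⊕ x) · correction n m)
    ≈[ N ] x ⊕ ⊖ (const (sign m) · mono (k * (suc m * suc n)) · ratios k m)
  telescope {N} n zero = ≈-trans
    (solve 1 (λ x → (con (+ 1) :+ :- x) :* con (+ 0) :+ :- ((con (+ 1) :+ x) :* con (+ 0))
                  := x :+ :- (con (+ 1) :* x :* con (+ 1))) ≈-refl (mono (k * suc n)))
    (⊕-cong ≈-refl (⊖-cong (·-congʳ 𝟏 (·-congˡ 𝟏 (mono-cong (cong (k *_) (sym (ℕₚ.*-identityˡ (suc n)))))))))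
  telescope {N} n (suc m) = begin
    (𝟏 ⊕ ⊖ x) · (c′ ⊕ const (- sign m) · (g · β) · h · mono (k * (suc m * suc (suc n))))
      ⊕ ⊖ ((𝟏 ⊕ x) · (c ⊕ const (- sign m) · (g · β) · h · y))
      ≈⟨ ⊕-cong (·-congˡ (𝟏 ⊕ ⊖ x) (⊕-cong ≈-refl
           (·-cong (·-congʳ h (·-congʳ (g · β) (const-neg (sign m))))
             (mono-product (k * (suc m * suc n)) (k * suc m) (exponent₁ k m n)))))
         (⊖-cong (·-congˡ (𝟏 ⊕ x) (⊕-cong ≈-refl
           (·-congʳ y (·-congʳ h (·-congʳ (g · β) (const-neg (sign m)))))))) ⟩
    (𝟏 ⊕ ⊖ x) · (c′ ⊕ (⊖ ε) · (g · β) · h · (y · z)) ⊕ ⊖ ((𝟏 ⊕ x) · (c ⊕ (⊖ ε) · (g · β) · h · y))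
      ≈⟨ solve 9 (λ x y z c c′ ε g β h → let o = con (+ 1) in
           (o :+ :- x) :* (c′ :+ (:- ε) :* (g :* β) :* h :* (y :* z))
             :+ :- ((o :+ x) :* (c :+ (:- ε) :* (g :* β) :* h :* y))
           := (o :+ :- x) :* c′ :+ :- ((o :+ x) :* c)
             :+ (ε :* g :* h :* y :* ((o :+ :- z) :* β) :+ ε :* g :* β :* x :* y :* ((o :+ z) :* h)))
           ≈-refl x y z c c′ ε g β h ⟩
    (𝟏 ⊕ ⊖ x) · c′ ⊕ ⊖ ((𝟏 ⊕ x) · c)
      ⊕ (ε · g · h · y · ((𝟏 ⊕ ⊖ z) · β) ⊕ ε · g · β · x · y · ((𝟏 ⊕ z) · h))
      ≈⟨ ⊕-cong (telescope n m) (⊕-cong (·-congˡ (ε · g · h · y) (ratio-spec (k * suc m)))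
           (·-congˡ (ε · g · β · x · y) h-spec)) ⟩
    x ⊕ ⊖ (ε · y · g) ⊕ (ε · g · h · y · (𝟏 ⊕ z) ⊕ ε · g · β · x · y · 𝟏)
      ≈⟨ solve 7 (λ x y z ε g β h → let o = con (+ 1) in
           x :+ :- (ε :* y :* g) :+ (ε :* g :* h :* y :* (o :+ z) :+ ε :* g :* β :* x :* y :* o)
           := x :+ :- (ε :* y :* g) :+ (ε :* g :* y :* ((o :+ z) :* h) :+ ε :* g :* β :* x :* y :* o))
           ≈-refl x y z ε g β h ⟩
    x ⊕ ⊖ (ε · y · g) ⊕ (ε · g · y · ((𝟏 ⊕ z) · h) ⊕ ε · g · β · x · y · 𝟏)
      ≈⟨ ⊕-cong ≈-refl (⊕-cong (·-congˡ (ε · g · y) h-spec) ≈-refl) ⟩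
    x ⊕ ⊖ (ε · y · g) ⊕ (ε · g · y · 𝟏 ⊕ ε · g · β · x · y · 𝟏)
      ≈⟨ solve 5 (λ x y ε g β → let o = con (+ 1) in
           x :+ :- (ε :* y :* g) :+ (ε :* g :* y :* o :+ ε :* g :* β :* x :* y :* o)
           := x :+ :- ((:- ε) :* (x :* y) :* (g :* β))) ≈-refl x y ε g β ⟩
    x ⊕ ⊖ ((⊖ ε) · (x · y) · (g · β))
      ≈⟨ ⊕-cong ≈-refl (⊖-cong (·-congʳ (g · β) (·-cong (const-neg (sign m))
           (mono-product (k * suc n) (k * (suc m * suc n)) (exponent₂ k m n))))) ⟨
    x ⊕ ⊖ (const (- sign m) · mono (k * (suc (suc m) * suc n)) · (g · β)) ∎
    where
    x = mono (k * suc n)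
    y = mono (k * (suc m * suc n))
    z = mono (k * suc m)
    c = correction n m
    c′ = correction (suc n) m
    ε = const (sign m)
    g = ratios k m
    β = ratio (k * suc m)
    h = geom (- + 1) (k * suc m)
    h-spec : (𝟏 ⊕ z) · h ≈[ N ] 𝟏
    h-spec = geom₋-inverse (k * suc m)
    exponent₁ : ∀ k m n → k * (suc m * suc n) + k * suc m ≡ k * (suc m * suc (suc n))
    exponent₁ = ℕ-Solver.solve-∀
    exponent₂ : ∀ k m n → k * suc n + k * (suc m * suc n) ≡ k * (suc (suc m) * suc n)
    exponent₂ = ℕ-Solver.solve-∀

  -- Induction on `n`, after multiplying both sides by 1 - x with x = q^(k(n+1)). `telescope` at m =
  -- n trades `correction n n` for `correction (suc n) n` and absorbs part of the new theta term;
  -- the rest is 1 - x times twice the last summand of `correction (suc n) (suc n)`.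
  correction-spec : ∀ {N} n → ratios k n · θ sign k n ≈[ N ] 𝟏 ⊕ const (+ 2) · correction n n
  correction-spec {N} zero = solve 0 (con (+ 1) :* con (+ 1) := con (+ 1) :+ con (+ 2) :* con (+ 0)) ≈-refl
  correction-spec {N} (suc n) = begin
    lhs                                    ≈⟨ cancel lhs ⟨
    (𝟏 ⊕ ⊖ x) · lhs · geom (+ 1) (k * suc n) ≈⟨ ·-congʳ (geom (+ 1) (k * suc n)) multiplied ⟩
    (𝟏 ⊕ ⊖ x) · rhs · geom (+ 1) (k * suc n) ≈⟨ cancel rhs ⟩
    rhs ∎
    where
    x = mono (k * suc n)
    w = mono (k * (suc n * suc n))
    t = θ sign k n
    c = correction n n
    c′ = correction (suc n) n
    ε = const (sign n)
    g = ratios k n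
    β = ratio (k * suc n)
    h = geom (- + 1) (k * suc n)
    lhs = ratios k (suc n) · θ sign k (suc n)
    rhs = 𝟏 ⊕ const (+ 2) · correction (suc n) (suc n)
    cancel : ∀ f → (𝟏 ⊕ ⊖ x) · f · geom (+ 1) (k * suc n) ≈[ N ] f
    cancel f = begin
      (𝟏 ⊕ ⊖ x) · f · geom (+ 1) (k * suc n)
        ≈⟨ solve 3 (λ a f g → a :* f :* g := a :* g :* f) ≈-refl (𝟏 ⊕ ⊖ x) f (geom (+ 1) (k * suc n)) ⟩
      (𝟏 ⊕ ⊖ x) · geom (+ 1) (k * suc n) · f
        ≈⟨ ·-congʳ f (geom₊-inverse (k * suc n)) ⟩
      𝟏 · f ≈⟨ ·-identityˡ f ⟩
      f ∎
    exponent : ∀ k n → k * (suc n * suc n) + k * suc n ≡ k * (suc n * suc (suc n))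
    exponent = ℕ-Solver.solve-∀
    multiplied : (𝟏 ⊕ ⊖ x) · lhs ≈[ N ] (𝟏 ⊕ ⊖ x) · rhs
    multiplied = begin
      (𝟏 ⊕ ⊖ x) · (g · β · (t ⊕ (const (- sign n) ⊕ const (- sign n)) · w))
        ≈⟨ ·-congˡ (𝟏 ⊕ ⊖ x) (·-congˡ (g · β) (⊕-cong ≈-refl
             (·-congʳ w (⊕-cong (const-neg (sign n)) (const-neg (sign n)))))) ⟩
      (𝟏 ⊕ ⊖ x) · (g · β · (t ⊕ (⊖ ε ⊕ ⊖ ε) · w))
        ≈⟨ solve 6 (λ x g β t ε w → let o = con (+ 1) in
             (o :+ :- x) :* (g :* β :* (t :+ (:- ε :+ :- ε) :* w))
             := (o :+ :- x) :* β :* (g :* t :+ :- (con (+ 2) :* ε :* w :* g))) ≈-refl x g β t ε w ⟩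
      (𝟏 ⊕ ⊖ x) · β · (g · t ⊕ ⊖ (const (+ 2) · ε · w · g))
        ≈⟨ ·-cong (ratio-spec (k * suc n)) (⊕-cong (correction-spec n) ≈-refl) ⟩
      (𝟏 ⊕ x) · (𝟏 ⊕ const (+ 2) · c ⊕ ⊖ (const (+ 2) · ε · w · g))
        ≈⟨ solve 5 (λ x c ε w g → let o = con (+ 1); two = con (+ 2) in
             (o :+ x) :* (o :+ two :* c :+ :- (two :* ε :* w :* g))
             := o :+ :- x :+ two :* (x :+ :- (ε :* w :* g)) :+ two :* ((o :+ x) :* c)
                :+ :- (two :* ε :* g :* w :* x :* o)) ≈-refl x c ε w g ⟩
      𝟏 ⊕ ⊖ x ⊕ const (+ 2) · (x ⊕ ⊖ (ε · w · g)) ⊕ const (+ 2) · ((𝟏 ⊕ x) · c)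
        ⊕ ⊖ (const (+ 2) · ε · g · w · x · 𝟏)
        ≈⟨ ⊕-cong (⊕-cong (⊕-cong ≈-refl (·-congˡ (const (+ 2)) (telescope n n))) ≈-refl)
             (⊖-cong (·-congˡ (const (+ 2) · ε · g · w · x) (geom₋-inverse (k * suc n)))) ⟨
      𝟏 ⊕ ⊖ x ⊕ const (+ 2) · ((𝟏 ⊕ ⊖ x) · c′ ⊕ ⊖ ((𝟏 ⊕ x) · c)) ⊕ const (+ 2) · ((𝟏 ⊕ x) · c)
        ⊕ ⊖ (const (+ 2) · ε · g · w · x · ((𝟏 ⊕ x) · h))
        ≈⟨ solve 7 (λ x c c′ ε w g h → let o = con (+ 1); two = con (+ 2) in
             o :+ :- x :+ two :* ((o :+ :- x) :* c′ :+ :- ((o :+ x) :* c)) :+ two :* ((o :+ x) :* c)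
               :+ :- (two :* ε :* g :* w :* x :* ((o :+ x) :* h))
             := o :+ :- x :+ two :* ((o :+ :- x) :* c′)
               :+ :- (two :* ε :* g :* w :* x :* h :* (o :+ x))) ≈-refl x c c′ ε w g h ⟩
      𝟏 ⊕ ⊖ x ⊕ const (+ 2) · ((𝟏 ⊕ ⊖ x) · c′) ⊕ ⊖ (const (+ 2) · ε · g · w · x · h · (𝟏 ⊕ x))
        ≈⟨ ⊕-cong ≈-refl (⊖-cong (·-congˡ (const (+ 2) · ε · g · w · x · h) (ratio-spec (k * suc n)))) ⟨
      𝟏 ⊕ ⊖ x ⊕ const (+ 2) · ((𝟏 ⊕ ⊖ x) · c′) ⊕ ⊖ (const (+ 2) · ε · g · w · x · h · ((𝟏 ⊕ ⊖ x) · β))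
        ≈⟨ solve 7 (λ x c′ ε w g h β → let o = con (+ 1); two = con (+ 2) in
             o :+ :- x :+ two :* ((o :+ :- x) :* c′)
               :+ :- (two :* ε :* g :* w :* x :* h :* ((o :+ :- x) :* β))
             := (o :+ :- x) :* (o :+ two :* (c′ :+ (:- ε) :* (g :* β) :* h :* (w :* x))))
             ≈-refl x c′ ε w g h β ⟩
      (𝟏 ⊕ ⊖ x) · (𝟏 ⊕ const (+ 2) · (c′ ⊕ (⊖ ε) · (g · β) · h · (w · x)))
        ≈⟨ ·-congˡ (𝟏 ⊕ ⊖ x) (⊕-cong ≈-refl (·-congˡ (const (+ 2)) (⊕-cong ≈-refl
             (·-cong (·-congʳ h (·-congʳ (g · β) (const-neg (sign n)))) (mono-product (k * (suc n * suc n)) (k * suc n) (exponent k n)))))) ⟨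
      (𝟏 ⊕ ⊖ x) · rhs ∎

  correction-vanish : ∀ n m → correction n m ≈[ n ] const (+ 0)
  correction-vanish n zero    = ≈-refl
  correction-vanish n (suc m) = begin
    correction n m ⊕ f · mono (k * (suc m * suc n))
      ≈⟨ ⊕-cong (correction-vanish n m) (·-congˡ f (mono-high large)) ⟩
    const (+ 0) ⊕ f · const (+ 0)
      ≈⟨ solve 1 (λ f → con (+ 0) :+ f :* con (+ 0) := con (+ 0)) ≈-refl f ⟩
    const (+ 0) ∎
    where
    f = const (sign (suc m)) · ratios k (suc m) · geom (- + 1) (k * suc m)
    large : n < k * (suc m * suc n)
    large = ℕₚ.≤-trans (ℕₚ.m≤m+n (suc n) (m * suc n)) (ℕₚ.m≤n*m (suc m * suc n) k)

  theta-product : ∀ n → ratios k n · θ sign k n ≈[ n ] 𝟏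
  theta-product n = begin
    ratios k n · θ sign k n             ≈⟨ correction-spec n ⟩
    𝟏 ⊕ const (+ 2) · correction n n    ≈⟨ ⊕-cong ≈-refl (·-congˡ (const (+ 2)) (correction-vanish n n)) ⟩
    𝟏 ⊕ const (+ 2) · const (+ 0)
      ≈⟨ solve 0 (con (+ 1) :+ con (+ 2) :* con (+ 0) := con (+ 1)) ≈-refl ⟩
    𝟏 ∎

  θ-stable : ∀ ε n d → θ ε k (d + n) ≈[ n ] θ ε k n
  θ-stable ε n zero    = ≈-refl
  θ-stable ε n (suc d) = begin
    θ ε k (d + n) ⊕ e · mono (k * (suc (d + n) * suc (d + n)))
      ≈⟨ ⊕-cong (θ-stable ε n d) (·-congˡ e (mono-high large)) ⟩
    θ ε k n ⊕ e · const (+ 0)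
      ≈⟨ solve 2 (λ t e → t :+ e :* con (+ 0) := t) ≈-refl (θ ε k n) e ⟩
    θ ε k n ∎
    where
    e = const (ε (suc (d + n))) ⊕ const (ε (suc (d + n)))
    large : n < k * (suc (d + n) * suc (d + n))
    large = ℕₚ.≤-trans (s≤s (ℕₚ.m≤n+m n d))
      (ℕₚ.≤-trans (ℕₚ.m≤m*n (suc (d + n)) (suc (d + n))) (ℕₚ.m≤n*m _ k))

open Gauss using (theta-product; θ-stable)

-- The truncations `oddRatios k n` of B_k, and theta series under q ↦ q² and q ↦ -q

oddRatios : ℕ → ℕ → Series
oddRatios k zero    = 𝟏
oddRatios k (suc n) = oddRatios k n · ratio (k * (2 * n + 1))

ratios-split : ∀ {N} k n → ratios k (2 * n) ≈[ N ] oddRatios k n · ratios (2 * k) n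
ratios-split k zero    = ≈-sym (·-identityˡ 𝟏)
ratios-split k (suc n) = begin
  ratios k (2 * suc n)
    ≈⟨ ≈-reflexive (cong (ratios k) (ℕₚ.*-suc 2 n)) ⟩
  ratios k (2 * n) · ratio (k * suc (2 * n)) · ratio (k * suc (suc (2 * n)))
    ≈⟨ ·-cong (·-cong (ratios-split k n) (≈-reflexive (cong ratio (odd k n))))
         (≈-reflexive (cong ratio (even k n))) ⟩
  oddRatios k n · ratios (2 * k) n · ratio (k * (2 * n + 1)) · ratio (2 * k * suc n)
    ≈⟨ solve 4 (λ p g a b → p :* g :* a :* b := p :* a :* (g :* b)) ≈-refl
         (oddRatios k n) (ratios (2 * k) n) (ratio (k * (2 * n + 1))) (ratio (2 * k * suc n)) ⟩
  oddRatios k n · ratio (k * (2 * n + 1)) · (ratios (2 * k) n · ratio (2 * k * suc n)) ∎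
  where
  odd : ∀ k n → k * suc (2 * n) ≡ k * (2 * n + 1)
  odd = ℕ-Solver.solve-∀
  even : ∀ k n → k * suc (suc (2 * n)) ≡ 2 * k * suc n
  even = ℕ-Solver.solve-∀

dil-θ : ∀ {N} ε k n → dil (θ ε k n) ≈[ N ] θ ε (2 * k) n
dil-θ ε k zero    = dil-const (ε 0)
dil-θ ε k (suc n) = begin
  dil (θ ε k n ⊕ (e ⊕ e) · mono m)        ≈⟨ dil-⊕ (θ ε k n) ((e ⊕ e) · mono m) ⟩
  dil (θ ε k n) ⊕ dil ((e ⊕ e) · mono m)  ≈⟨ ⊕-cong (dil-θ ε k n) (dil-· (e ⊕ e) (mono m)) ⟩
  θ ε (2 * k) n ⊕ dil (e ⊕ e) · dil (mono m)
    ≈⟨ ⊕-cong ≈-refl (·-cong (≈-trans (dil-⊕ e e) (⊕-cong (dil-const (ε (suc n))) (dil-const (ε (suc n)))))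
         (≈-trans (dil-mono m) (mono-cong (sym (ℕₚ.*-assoc 2 k (suc n * suc n)))))) ⟩
  θ ε (2 * k) n ⊕ (e ⊕ e) · mono (2 * k * (suc n * suc n)) ∎
  where
  e = const (ε (suc n))
  m = k * (suc n * suc n)

trivial : ℕ → ℤ
trivial _ = + 1

sign-odd-* : ∀ k → sign k ≡ - + 1 → ∀ n → sign (k * n) ≡ sign n
sign-odd-* k odd zero    = cong sign (ℕₚ.*-zeroʳ k)
sign-odd-* k odd (suc n) rewrite ℕₚ.*-suc k n | sign-+ k (k * n) | odd | sign-odd-* k odd n =
  ℤₚ.-1*i≡-i (sign n)

sign-* : ∀ m n → sign m ≡ + 1 → sign (m * n) ≡ + 1
sign-* m zero    even = cong sign (ℕₚ.*-zeroʳ m)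
sign-* m (suc n) even rewrite ℕₚ.*-suc m n | sign-+ m (m * n) | even | sign-* m n even = refl

sign-square : ∀ n → sign (n * n) ≡ sign n
sign-square zero    = refl
sign-square (suc n) rewrite ℕₚ.*-suc n n | sign-+ n (n + n * n) | sign-+ n (n * n) | sign-square n | sign-sq n =
  cong -_ (ℤₚ.*-identityʳ (sign n))

-- For odd k the exponent k s² has the parity of s, so the sign produced by q ↦ -q cancels the
-- weight (-1)^s.
neg-θ : ∀ {N} k n → sign k ≡ - + 1 → neg (θ sign k n) ≈[ N ] θ trivial k n
neg-θ k zero    odd = neg-const (+ 1)
neg-θ k (suc n) odd = begin
  neg (θ sign k n ⊕ (e ⊕ e) · mono m)        ≈⟨ neg-⊕ (θ sign k n) ((e ⊕ e) · mono m) ⟩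
  neg (θ sign k n) ⊕ neg ((e ⊕ e) · mono m)  ≈⟨ ⊕-cong (neg-θ k n odd) (neg-· (e ⊕ e) (mono m)) ⟩
  θ trivial k n ⊕ neg (e ⊕ e) · neg (mono m)
    ≈⟨ ⊕-cong ≈-refl (·-cong (≈-trans (neg-⊕ e e) (⊕-cong (neg-const s) (neg-const s)))
         (≈-trans (neg-mono m) (·-congʳ (mono m) (≈-reflexive (cong const sign-m))))) ⟩
  θ trivial k n ⊕ (e ⊕ e) · (e · mono m)
    ≈⟨ solve 3 (λ t e x → t :+ (e :+ e) :* (e :* x) := t :+ (e :* e :+ e :* e) :* x) ≈-refl
         (θ trivial k n) e (mono m) ⟩
  θ trivial k n ⊕ (e · e ⊕ e · e) · mono m
    ≈⟨ ⊕-cong ≈-refl (·-congʳ (mono m) (⊕-cong e² e²)) ⟩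
  θ trivial k n ⊕ (𝟏 ⊕ 𝟏) · mono m ∎
  where
  s = sign (suc n)
  e = const s
  m = k * (suc n * suc n)
  sign-m : sign m ≡ s
  sign-m = trans (sign-odd-* k odd (suc n * suc n)) (sign-square (suc n))
  e² : ∀ {N} → e · e ≈[ N ] 𝟏
  e² = ≈-trans (≈-sym (const-* s s)) (≈-reflexive (cong const (sign-sq (suc n))))

-- By Gauss, φ(-q^k) is inverse to the product over all indices. Its even indices form the product
-- for 2k, which is inverse to φ(-q^(2k)); the odd indices, that is B_k, are what remains.
θ-dilation : ∀ k .{{_ : NonZero k}} n → dil (θ sign k n) ≈[ n ] oddRatios k n · θ sign k n
θ-dilation k@(suc _) n = begin
  dil (θ sign k n)                    ≈⟨ dil-θ sign k n ⟩
  t₂                                  ≈⟨ ·-identityʳ t₂ ⟨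
  t₂ · 𝟏                              ≈⟨ ·-congˡ t₂ t-spec ⟨
  t₂ · (p · g₂ · t)                   ≈⟨ solve 4 (λ t₂ p g₂ t → t₂ :* (p :* g₂ :* t) := p :* t :* (g₂ :* t₂))
                                           ≈-refl t₂ p g₂ t ⟩
  p · t · (g₂ · t₂)                   ≈⟨ ·-congˡ (p · t) (theta-product (2 * k) n) ⟩
  p · t · 𝟏                           ≈⟨ ·-identityʳ (p · t) ⟩
  p · t                               ∎
  where
  t = θ sign k n
  t₂ = θ sign (2 * k) n
  p = oddRatios k n
  g₂ = ratios (2 * k) n
  t-spec : p · g₂ · t ≈[ n ] 𝟏
  t-spec = begin
    -- Odd and even parts with n factors each make 2n factors, so the theta sum is lengthened from n
    -- to 2n terms, which is invisible modulo q^(n+1).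
    p · g₂ · t                              ≈⟨ ·-cong (ratios-split k n) (θ-stable k sign n n) ⟨
    ratios k (2 * n) · θ sign k (n + n)     ≈⟨ ·-congˡ (ratios k (2 * n)) (≈-reflexive (cong (θ sign k)
                                                 (cong (_+_ n) (sym (ℕₚ.+-identityʳ n))))) ⟩
    ratios k (2 * n) · θ sign k (2 * n)     ≈⟨ ≈-weaken (ℕₚ.m≤m+n n _) (theta-product k (2 * n)) ⟩
    𝟏 ∎

-- For odd m, q ↦ -q exchanges 1 + q^m and 1 - q^m, hence numerator and denominator.
ratio-neg : ∀ {N} m .{{_ : NonZero m}} → sign m ≡ - + 1 → ratio m · neg (ratio m) ≈[ N ] 𝟏
ratio-neg {N} m odd = begin
  (𝟏 ⊕ x) · g · neg ((𝟏 ⊕ x) · g)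
    ≈⟨ ·-congˡ ((𝟏 ⊕ x) · g) (≈-trans (neg-· (𝟏 ⊕ x) g) (·-congʳ (neg g) neg-1+x)) ⟩
  (𝟏 ⊕ x) · g · ((𝟏 ⊕ ⊖ x) · neg g)
    ≈⟨ solve 4 (λ a b g g′ → a :* g :* (b :* g′) := b :* g :* (a :* g′)) ≈-refl
         (𝟏 ⊕ x) (𝟏 ⊕ ⊖ x) g (neg g) ⟩
  (𝟏 ⊕ ⊖ x) · g · ((𝟏 ⊕ x) · neg g)
    ≈⟨ ·-cong (geom₊-inverse m) neg-geom ⟩
  𝟏 · 𝟏 ≈⟨ ·-identityˡ 𝟏 ⟩
  𝟏 ∎
  where
  x = mono m
  g = geom (+ 1) m
  neg-x : ∀ {N} → neg x ≈[ N ] const (- + 1) · x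
  neg-x = ≈-trans (neg-mono m) (≈-reflexive (cong (λ s → const s · x) odd))
  neg-1+x : ∀ {N} → neg (𝟏 ⊕ x) ≈[ N ] 𝟏 ⊕ ⊖ x
  neg-1+x = begin
    neg (𝟏 ⊕ x)              ≈⟨ neg-⊕ 𝟏 x ⟩
    neg 𝟏 ⊕ neg x            ≈⟨ ⊕-cong (neg-const (+ 1)) neg-x ⟩
    𝟏 ⊕ const (- + 1) · x    ≈⟨ ≈-neg-mono m ⟩
    𝟏 ⊕ ⊖ x                  ∎
  neg-geom : (𝟏 ⊕ x) · neg g ≈[ N ] 𝟏
  neg-geom = begin
    (𝟏 ⊕ x) · neg g
      -- Writing x as (-1)((-1)x) exhibits 1 + x as the image of 1 - x under q ↦ -q.
      ≈⟨ solve 2 (λ x g → (con (+ 1) :+ x) :* g := (con (+ 1) :+ con (- + 1) :* (con (- + 1) :* x)) :* g)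
           ≈-refl x (neg g) ⟩
    (𝟏 ⊕ const (- + 1) · (const (- + 1) · x)) · neg g
      ≈⟨ ·-congʳ (neg g) (⊕-cong (neg-const (+ 1)) (≈-trans (neg-· (const (- + 1)) x)
           (·-cong (neg-const (- + 1)) neg-x))) ⟨
    (neg 𝟏 ⊕ neg (const (- + 1) · x)) · neg g
      ≈⟨ ·-congʳ (neg g) (neg-⊕ 𝟏 (const (- + 1) · x)) ⟨
    neg (𝟏 ⊕ const (- + 1) · x) · neg g
      ≈⟨ neg-· (𝟏 ⊕ const (- + 1) · x) g ⟨
    neg ((𝟏 ⊕ const (- + 1) · x) · g)
      ≈⟨ neg-cong (≈-trans (·-congʳ g (≈-neg-mono m)) (geom₊-inverse m)) ⟩
    neg 𝟏 ≈⟨ neg-const (+ 1) ⟩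
    𝟏 ∎

2n+1-nonZero : ∀ n → NonZero (2 * n + 1)
2n+1-nonZero n = ℕ.≢-nonZero (ℕₚ.m+1+n≢0 (2 * n))

oddRatios-neg : ∀ {N} k .{{_ : NonZero k}} n → sign k ≡ - + 1 →
                oddRatios k n · neg (oddRatios k n) ≈[ N ] 𝟏
oddRatios-neg k zero    odd = ≈-trans (·-identityˡ (neg 𝟏)) (neg-const (+ 1))
oddRatios-neg k (suc n) odd = begin
  p · b · neg (p · b)          ≈⟨ ·-congˡ (p · b) (neg-· p b) ⟩
  p · b · (neg p · neg b)
    ≈⟨ solve 4 (λ p b p′ b′ → p :* b :* (p′ :* b′) := p :* p′ :* (b :* b′)) ≈-refl p b (neg p) (neg b) ⟩
  p · neg p · (b · neg b)      ≈⟨ ·-cong (oddRatios-neg k n odd) (ratio-neg m sign-m) ⟩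
  𝟏 · 𝟏                        ≈⟨ ·-identityˡ 𝟏 ⟩
  𝟏                            ∎
  where
  m = k * (2 * n + 1)
  p = oddRatios k n
  b = ratio m
  instance
    2n+1≢0 : NonZero (2 * n + 1)
    2n+1≢0 = 2n+1-nonZero n
    m≢0 : NonZero m
    m≢0 = ℕₚ.m*n≢0 k (2 * n + 1)
  sign-m : sign m ≡ - + 1
  sign-m = trans (sign-odd-* k odd (2 * n + 1)) (trans (sign-+ (2 * n) 1) (cong (_*ℤ - + 1) (sign-2* n)))
    where
    sign-2* : ∀ n → sign (2 * n) ≡ + 1
    sign-2* n = sign-* 2 n refl

-- After n factors the next exponent is k(2n+1), which exceeds N as soon as N ≤ 2n.
oddRatios-stable : ∀ k .{{_ : NonZero k}} {N n n′} → N ≤ 2 * n → n ≤ n′ →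
                   oddRatios k n′ ≈[ N ] oddRatios k n
oddRatios-stable k {N} {n} {n′} N≤2n n≤n′ =
  subst (λ i → oddRatios k i ≈[ N ] oddRatios k n) (ℕₚ.m∸n+n≡m n≤n′) (go (n′ ∸ n))
  where
  large : ∀ d → N < k * (2 * (d + n) + 1)
  large d = ℕₚ.<-≤-trans
    (ℕₚ.≤-<-trans (ℕₚ.≤-trans N≤2n (ℕₚ.*-monoʳ-≤ 2 (ℕₚ.m≤n+m n d))) (ℕₚ.m<m+n (2 * (d + n)) (s≤s z≤n)))
    (ℕₚ.m≤n*m (2 * (d + n) + 1) k)
  go : ∀ d → oddRatios k (d + n) ≈[ N ] oddRatios k n
  go zero    = ≈-refl
  go (suc d) = begin
    oddRatios k (d + n) · ratio (k * (2 * (d + n) + 1))    ≈⟨ ·-cong (go d) (ratio-high (large d)) ⟩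
    oddRatios k n · 𝟏                                      ≈⟨ ·-identityʳ (oddRatios k n) ⟩
    oddRatios k n                                          ∎

-- The Schur product

schurFactor : ℕ → Series
schurFactor m = (𝟏 ⊕ mono m) · (𝟏 ⊕ ⊖ mono (3 * m)) · geom (- + 1) (3 * m) · geom (+ 1) m

schur : ℕ → Series
schur zero    = 𝟏
schur (suc n) = schur n · schurFactor (2 * n + 1)

⊛≈· : ∀ {N f f′ g g′} → f ≈[ N ] f′ → g ≈[ N ] g′ → f ⊛ g ≈[ N ] f′ · g′
⊛≈· {f = f} {g = g} f≈ g≈ = ≈-trans (exactly λ n → sym (·-coeff f g n)) (·-cong f≈ g≈)

one≈𝟏 : ∀ {N} → one ≈[ N ] 𝟏
one≈𝟏 = exactly λ where
  zero    → refl
  (suc n) → refl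

factor≈ : ∀ {N} m .{{_ : NonZero m}} → factor m ≈[ N ] schurFactor m
factor≈ m = ⊛≈· (⊛≈· (⊛≈·
    (≈-trans (binom-mono (+ 1) m) (⊕-cong ≈-refl (·-identityˡ (mono m))))
    (≈-trans (binom-mono (- + 1) (3 * m)) (≈-neg-mono (3 * m))))
  ≈-refl) ≈-refl
  where instance _ = ℕₚ.m*n≢0 3 m

prodTo₁ : ∀ {N} n → prodTo 1 n ≈[ N ] schur n
prodTo₁ zero    = one≈𝟏
prodTo₁ (suc n) = ⊛≈· (prodTo₁ n)
  (≈-trans (⊛≈· (factor≈ (2 * n + 1)) one≈𝟏) (·-identityʳ (schurFactor (2 * n + 1))))
  where instance _ = 2n+1-nonZero n

prodTo₂ : ∀ {N} n → prodTo 2 n ≈[ N ] schur n · schur n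
prodTo₂ zero    = ≈-trans one≈𝟏 (≈-sym (·-identityˡ 𝟏))
prodTo₂ (suc n) = ≈-trans
  (⊛≈· (prodTo₂ n) (⊛≈· (factor≈ (2 * n + 1)) (⊛≈· (factor≈ (2 * n + 1)) one≈𝟏)))
  (solve 2 (λ s f → s :* s :* (f :* (f :* con (+ 1))) := s :* f :* (s :* f)) ≈-refl
    (schur n) (schurFactor (2 * n + 1)))
  where instance _ = 2n+1-nonZero n

schur-ratio : ∀ {N} n → schur n · oddRatios 3 n ≈[ N ] oddRatios 1 n
schur-ratio zero    = ·-identityˡ 𝟏
schur-ratio (suc n) = begin
  s · (a · (𝟏 ⊕ ⊖ y) · h · g) · (p · ((𝟏 ⊕ y) · g₃))
    ≈⟨ solve 7 (λ s a y h g p g₃ → let o = con (+ 1) in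
         s :* (a :* (o :+ :- y) :* h :* g) :* (p :* ((o :+ y) :* g₃))
         := s :* p :* (a :* g) :* (((o :+ :- y) :* g₃) :* ((o :+ y) :* h))) ≈-refl s a y h g p g₃ ⟩
  s · p · (a · g) · (((𝟏 ⊕ ⊖ y) · g₃) · ((𝟏 ⊕ y) · h))
    ≈⟨ ·-cong (·-congʳ (a · g) (schur-ratio n)) (·-cong (geom₊-inverse (3 * m)) (geom₋-inverse (3 * m))) ⟩
  oddRatios 1 n · ratio m · (𝟏 · 𝟏)
    ≈⟨ solve 2 (λ p b → p :* b :* (con (+ 1) :* con (+ 1)) := p :* b) ≈-refl (oddRatios 1 n) (ratio m) ⟩
  oddRatios 1 n · ratio m
    ≈⟨ ·-congˡ (oddRatios 1 n) (≈-reflexive (cong ratio (sym (ℕₚ.*-identityˡ m)))) ⟩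
  oddRatios 1 n · ratio (1 * m) ∎
  where
  m = 2 * n + 1
  instance
    m≢0 : NonZero m
    m≢0 = 2n+1-nonZero n
    3m≢0 : NonZero (3 * m)
    3m≢0 = ℕₚ.m*n≢0 3 m
  s = schur n
  p = oddRatios 3 n
  a = 𝟏 ⊕ mono m
  y = mono (3 * m)
  h = geom (- + 1) (3 * m)
  g = geom (+ 1) m
  g₃ = geom (+ 1) (3 * m)

-- This is S = u/v, with `neg v` standing for 1/v.
schur≈ : ∀ {N} n → schur n ≈[ N ] oddRatios 1 n · neg (oddRatios 3 n)
schur≈ n = begin
  s                              ≈⟨ ·-identityʳ s ⟨
  s · 𝟏                          ≈⟨ ·-congˡ s (oddRatios-neg 3 n refl) ⟨
  s · (v · neg v)                ≈⟨ ·-assoc s v (neg v) ⟨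
  s · v · neg v                  ≈⟨ ·-congʳ (neg v) (schur-ratio n) ⟩
  oddRatios 1 n · neg v          ∎
  where
  s = schur n
  v = oddRatios 3 n

schur-stable : ∀ {N n n′} → N ≤ 2 * n → n ≤ n′ → schur n′ ≈[ N ] schur n
schur-stable {n = n} {n′} N≤2n n≤n′ = begin
  schur n′                                  ≈⟨ schur≈ n′ ⟩
  oddRatios 1 n′ · neg (oddRatios 3 n′)
    ≈⟨ ·-cong (oddRatios-stable 1 N≤2n n≤n′) (neg-cong (oddRatios-stable 3 N≤2n n≤n′)) ⟩
  oddRatios 1 n · neg (oddRatios 3 n)       ≈⟨ schur≈ n ⟨
  schur n                                   ∎

-- Finite sums over lists

private variable
  A B : Set

wsum : (A → ℤ) → List A → ℤ
wsum c []       = + 0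
wsum c (x ∷ xs) = c x +ℤ wsum c xs

wsum-cong : ∀ {c d : A → ℤ} → (∀ x → c x ≡ d x) → ∀ xs → wsum c xs ≡ wsum d xs
wsum-cong c≡d []       = refl
wsum-cong c≡d (x ∷ xs) = cong₂ _+ℤ_ (c≡d x) (wsum-cong c≡d xs)

wsum-+ : ∀ (c d : A → ℤ) xs → wsum c xs +ℤ wsum d xs ≡ wsum (λ x → c x +ℤ d x) xs
wsum-+ c d []       = refl
wsum-+ c d (x ∷ xs) = trans (interchange (c x) (wsum c xs) (d x) (wsum d xs))
                            (cong (c x +ℤ d x +ℤ_) (wsum-+ c d xs))
  where
  interchange : ∀ a b c d → a +ℤ b +ℤ (c +ℤ d) ≡ a +ℤ c +ℤ (b +ℤ d)
  interchange = ℤ-solve-∀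

wsum-↭ : ∀ (c : A → ℤ) {xs ys} → xs ↭ ys → wsum c xs ≡ wsum c ys
wsum-↭ c Perm.refl         = refl
wsum-↭ c (Perm.prep x p)   = cong (c x +ℤ_) (wsum-↭ c p)
wsum-↭ c (Perm.swap x y p) = trans (cong (λ s → c x +ℤ (c y +ℤ s)) (wsum-↭ c p)) (exchange (c x) (c y) _)
  where
  exchange : ∀ a b s → a +ℤ (b +ℤ s) ≡ b +ℤ (a +ℤ s)
  exchange = ℤ-solve-∀
wsum-↭ c (Perm.trans p q)  = trans (wsum-↭ c p) (wsum-↭ c q)

wsum-map : ∀ (d : B → ℤ) (T : A → B) xs → wsum (d ∘ T) xs ≡ wsum d (map T xs)
wsum-map d T []       = refl
wsum-map d T (x ∷ xs) = cong (d (T x) +ℤ_) (wsum-map d T xs)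

wsum-support : ∀ (c : A → ℤ) xs → wsum c xs ≡ wsum c (filter (λ x → ¬? (c x ℤ.≟ + 0)) xs)
wsum-support c []       = refl
wsum-support c (x ∷ xs) with c x ℤ.≟ + 0
... | yes cx≡0 = trans (cong (_+ℤ wsum c xs) cx≡0) (trans (ℤₚ.+-identityˡ _) (wsum-support c xs))
... | no  _    = cong (c x +ℤ_) (wsum-support c xs)

-- A change of variables for lattice sums. `T` rarely maps one box onto the other, so both lists are
-- first cut down to the supports of the weights; there the image of one list and the other list are
-- duplicate-free with the same members, hence permutations of each other.
wsum-transfer : ∀ {c : A → ℤ} {d : B → ℤ} {xs ys} → Unique xs → Unique ys → (T : A → B) →
  (∀ {x y} → T x ≡ T y → x ≡ y) → (∀ x → c x ≡ d (T x)) →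
  (∀ {x} → c x ≢ + 0 → x ∈ xs) → (∀ {y} → d y ≢ + 0 → y ∈ ys) →
  (∀ y → d y ≢ + 0 → ∃ λ x → y ≡ T x) →
  wsum c xs ≡ wsum d ys
wsum-transfer {c = c} {d} {xs} {ys} xs! ys! T T-inj c≡dT c-supp d-supp T-surj = begin≡
  wsum c xs                        ≡⟨ wsum-support c xs ⟩
  wsum c (filter c? xs)            ≡⟨ wsum-cong c≡dT (filter c? xs) ⟩
  wsum (d ∘ T) (filter c? xs)      ≡⟨ wsum-map d T (filter c? xs) ⟩
  wsum d (map T (filter c? xs))    ≡⟨ wsum-↭ d (∼bag⇒↭ (unique∧set⇒bag
                                        (Uniqueₚ.map⁺ T-inj (Uniqueₚ.filter⁺ c? xs!))
                                        (Uniqueₚ.filter⁺ d? ys!)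
                                        (mk⇔ to from))) ⟩
  wsum d (filter d? ys)            ≡⟨ wsum-support d ys ⟨
  wsum d ys                        ∎≡
  where
  c? = λ x → ¬? (c x ℤ.≟ + 0)
  d? = λ y → ¬? (d y ℤ.≟ + 0)
  to : ∀ {y} → y ∈ map T (filter c? xs) → y ∈ filter d? ys
  to y∈ with ∈-map⁻ T y∈
  ... | x , x∈ , refl with proj₂ (∈-filter⁻ c? {xs = xs} x∈)
  ... | cx≢0 = ∈-filter⁺ d? (d-supp dTx≢0) dTx≢0
    where dTx≢0 = cx≢0 ∘ trans (c≡dT x)
  from : ∀ {y} → y ∈ filter d? ys → y ∈ map T (filter c? xs)
  from {y} y∈ with proj₂ (∈-filter⁻ d? {xs = ys} y∈)
  ... | dy≢0 with T-surj y dy≢0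
  ... | x , refl = ∈-map⁺ T (∈-filter⁺ c? (c-supp cx≢0) cx≢0)
    where cx≢0 = dy≢0 ∘ trans (sym (c≡dT x))

-- Boxes of lattice points

ints : ℕ → List ℤ
ints zero    = + 0 ∷ []
ints (suc n) = + suc n ∷ -[1+ n ] ∷ ints n

∈-ints⁺ : ∀ n {a} → ∣ a ∣ ≤ n → a ∈ ints n
∈-ints⁺ zero    {+ zero} _ = here refl
∈-ints⁺ (suc n) {a} a≤ with ∣ a ∣ ℕ.≟ suc n
... | no  a≢  = there (there (∈-ints⁺ n (ℕₚ.≤-pred (ℕₚ.≤∧≢⇒< a≤ a≢))))
∈-ints⁺ (suc n) {+ _}      a≤ | yes refl = here refl
∈-ints⁺ (suc n) { -[1+ _ ]} a≤ | yes refl = there (here refl)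

∈-ints⁻ : ∀ n {a} → a ∈ ints n → ∣ a ∣ ≤ n
∈-ints⁻ zero    (here refl)         = z≤n
∈-ints⁻ (suc n) (here refl)         = ℕₚ.≤-refl
∈-ints⁻ (suc n) (there (here refl)) = ℕₚ.≤-refl
∈-ints⁻ (suc n) (there (there a∈))  = ℕₚ.m≤n⇒m≤1+n (∈-ints⁻ n a∈)

ints-unique : ∀ n → Unique (ints n)
ints-unique zero    = [] ∷ []
ints-unique (suc n) =
  ((λ ()) ∷ All.tabulate (λ a∈ → λ { refl → ℕₚ.1+n≰n (∈-ints⁻ n a∈) }))
  ∷ All.tabulate (λ a∈ → λ { refl → ℕₚ.1+n≰n (∈-ints⁻ n a∈) })
  ∷ ints-unique n

box : ℕ → List (ℤ × ℤ)
box n = cartesianProduct (ints n) (ints n)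

box-unique : ∀ n → Unique (box n)
box-unique n = Uniqueₚ.cartesianProduct⁺ (ints-unique n) (ints-unique n)

∈-box : ∀ n {a b} → ∣ a ∣ ≤ n → ∣ b ∣ ≤ n → (a , b) ∈ box n
∈-box n a≤n b≤n = ∈-cartesianProduct⁺ (∈-ints⁺ n a≤n) (∈-ints⁺ n b≤n)

-- Products of theta series as lattice sums

lsum : (A → Series) → List A → Series
lsum F []       = const (+ 0)
lsum F (x ∷ xs) = F x ⊕ lsum F xs

lsum-coeff : ∀ (F : A → Series) xs n → lsum F xs n ≡ wsum (λ x → F x n) xs
lsum-coeff F []       n = const-0 n
lsum-coeff F (x ∷ xs) n = trans (⊕-coeff (F x) (lsum F xs) n) (cong (F x n +ℤ_) (lsum-coeff F xs n))

lsum-map : ∀ {N} (F : B → Series) (T : A → B) xs → lsum F (map T xs) ≈[ N ] lsum (F ∘ T) xs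
lsum-map F T []       = ≈-refl
lsum-map F T (x ∷ xs) = ⊕-cong ≈-refl (lsum-map F T xs)

lsum-++ : ∀ {N} (F : A → Series) xs ys → lsum F (xs ++ ys) ≈[ N ] lsum F xs ⊕ lsum F ys
lsum-++ F []       ys = ≈-sym (⊕-zeroˡ (lsum F ys))
lsum-++ F (x ∷ xs) ys = ≈-trans (⊕-cong ≈-refl (lsum-++ F xs ys))
                                (≈-sym (⊕-associative (F x) (lsum F xs) (lsum F ys)))

lsum-·ˡ : ∀ {N} f (G : A → Series) xs → f · lsum G xs ≈[ N ] lsum (λ x → f · G x) xs
lsum-·ˡ f G []       = ·-zeroʳ f
lsum-·ˡ f G (x ∷ xs) = ≈-trans (·-distribˡ f (G x) (lsum G xs)) (⊕-cong ≈-refl (lsum-·ˡ f G xs))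

lsum-· : ∀ {N} (F : A → Series) (G : B → Series) xs ys →
         lsum F xs · lsum G ys ≈[ N ] lsum (λ p → F (proj₁ p) · G (proj₂ p)) (cartesianProduct xs ys)
lsum-· F G []       ys = ·-zeroˡ (lsum G ys)
lsum-· F G (x ∷ xs) ys = begin
  (F x ⊕ lsum F xs) · lsum G ys
    ≈⟨ ·-distribʳ (lsum G ys) (F x) (lsum F xs) ⟩
  F x · lsum G ys ⊕ lsum F xs · lsum G ys
    ≈⟨ ⊕-cong (lsum-·ˡ (F x) G ys) (lsum-· F G xs ys) ⟩
  lsum (λ y → F x · G y) ys ⊕ lsum H (cartesianProduct xs ys)
    ≈⟨ ⊕-cong (lsum-map H (x ,_) ys) ≈-refl ⟨
  lsum H (map (x ,_) ys) ⊕ lsum H (cartesianProduct xs ys)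
    ≈⟨ lsum-++ H (map (x ,_) ys) (cartesianProduct xs ys) ⟨
  lsum H (map (x ,_) ys ++ cartesianProduct xs ys) ∎
  where
  H = λ p → F (proj₁ p) · G (proj₂ p)

θ-term : (ℕ → ℤ) → ℕ → ℤ → Series
θ-term ε k a = const (ε ∣ a ∣) · mono (k * (∣ a ∣ * ∣ a ∣))

θ-lsum : ∀ {N} ε k n → θ ε k n ≈[ N ] lsum (θ-term ε k) (ints n)
θ-lsum ε k zero = begin
  const (ε 0)                                        ≈⟨ ·-identityʳ (const (ε 0)) ⟨
  const (ε 0) · 𝟏                                    ≈⟨ ·-congˡ (const (ε 0)) mono-0 ⟨
  const (ε 0) · mono 0                               ≈⟨ ·-congˡ (const (ε 0)) (mono-cong (sym (ℕₚ.*-zeroʳ k))) ⟩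
  θ-term ε k (+ 0)                                   ≈⟨ ⊕-zeroʳ (θ-term ε k (+ 0)) ⟨
  θ-term ε k (+ 0) ⊕ const (+ 0)                     ∎
θ-lsum ε k (suc n) = begin
  θ ε k n ⊕ (e ⊕ e) · x
    ≈⟨ solve 3 (λ t e x → t :+ (e :+ e) :* x := e :* x :+ (e :* x :+ t)) ≈-refl (θ ε k n) e x ⟩
  e · x ⊕ (e · x ⊕ θ ε k n)
    ≈⟨ ⊕-cong ≈-refl (⊕-cong ≈-refl (θ-lsum ε k n)) ⟩
  e · x ⊕ (e · x ⊕ lsum (θ-term ε k) (ints n)) ∎
  where
  e = const (ε (suc n))
  x = mono (k * (suc n * suc n))

form : ℕ → ℕ → ℤ → ℤ → ℤ
form k l a b = + k *ℤ (a *ℤ a) +ℤ + l *ℤ (b *ℤ b)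

∣∣-square : ∀ a → + (∣ a ∣ * ∣ a ∣) ≡ a *ℤ a
∣∣-square (+ n)    = ℤₚ.pos-* n n
∣∣-square -[1+ n ] = refl

∣form∣ : ∀ k l a b → k * (∣ a ∣ * ∣ a ∣) + l * (∣ b ∣ * ∣ b ∣) ≡ ∣ form k l a b ∣
∣form∣ k l a b = cong ∣_∣ (trans (ℤₚ.pos-+ (k * (∣ a ∣ * ∣ a ∣)) _)
  (cong₂ _+ℤ_ (trans (ℤₚ.pos-* k _) (cong (+ k *ℤ_) (∣∣-square a)))
              (trans (ℤₚ.pos-* l _) (cong (+ l *ℤ_) (∣∣-square b)))))

opaque
  -- The coefficient of q^n in w q^|e|. Exponents are kept as integers so that identities between
  -- quadratic forms are ring identities; by `∣form∣` the absolute value recovers the natural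
  -- exponent.
  term : ℕ → ℤ → ℤ → ℤ
  term n w e = w *ℤ mono ∣ e ∣ n

  term-coeff : ∀ n w e → (const w · mono ∣ e ∣) n ≡ term n w e
  term-coeff n w e = const-· w (mono ∣ e ∣) n

  term-weight : ∀ n {w} e → term n w e ≢ + 0 → w ≢ + 0
  term-weight n e ≢0 refl = ≢0 refl

  term-exponent : ∀ n w e → term n w e ≢ + 0 → ∣ e ∣ ≡ n
  term-exponent n w e ≢0 = mono-supp ∣ e ∣ n λ ≡0 → ≢0 (trans (cong (w *ℤ_) ≡0) (ℤₚ.*-zeroʳ w))

  term-+ : ∀ n w w′ e → term n w e +ℤ term n w′ e ≡ term n (w +ℤ w′) e
  term-+ n w w′ e = sym (ℤₚ.*-distribʳ-+ (mono ∣ e ∣ n) w w′)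

θ-product : ∀ ε δ k l N n → (θ ε k N · θ δ l N) n ≡
  wsum (λ (a , b) → term n (ε ∣ a ∣ *ℤ δ ∣ b ∣) (form k l a b)) (box N)
θ-product ε δ k l N n = begin≡
  (θ ε k N · θ δ l N) n
    ≡⟨ ·-cong (θ-lsum ε k N) (θ-lsum δ l N) .at (ℕₚ.≤-refl {n}) ⟩
  (lsum (θ-term ε k) (ints N) · lsum (θ-term δ l) (ints N)) n
    ≡⟨ lsum-· (θ-term ε k) (θ-term δ l) (ints N) (ints N) .at (ℕₚ.≤-refl {n}) ⟩
  lsum (λ p → θ-term ε k (proj₁ p) · θ-term δ l (proj₂ p)) (box N) n
    ≡⟨ lsum-coeff (λ p → θ-term ε k (proj₁ p) · θ-term δ l (proj₂ p)) (box N) n ⟩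
  wsum (λ p → (θ-term ε k (proj₁ p) · θ-term δ l (proj₂ p)) n) (box N)
    ≡⟨ wsum-cong (λ (a , b) → coefficient a b) (box N) ⟩
  wsum (λ (a , b) → term n (ε ∣ a ∣ *ℤ δ ∣ b ∣) (form k l a b)) (box N) ∎≡
  where
  combine : ∀ {N} a b → θ-term ε k a · θ-term δ l b
    ≈[ N ] const (ε ∣ a ∣ *ℤ δ ∣ b ∣) · mono ∣ form k l a b ∣
  combine a b = ≈-trans
    (solve 4 (λ c x d y → c :* x :* (d :* y) := c :* d :* (x :* y)) ≈-refl
      (const (ε ∣ a ∣)) (mono (k * (∣ a ∣ * ∣ a ∣))) (const (δ ∣ b ∣)) (mono (l * (∣ b ∣ * ∣ b ∣))))
    (·-cong (≈-sym (const-* (ε ∣ a ∣) (δ ∣ b ∣)))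
      (≈-sym (mono-product (k * (∣ a ∣ * ∣ a ∣)) (l * (∣ b ∣ * ∣ b ∣)) (∣form∣ k l a b))))
  coefficient : ∀ a b → (θ-term ε k a · θ-term δ l b) n ≡ term n (ε ∣ a ∣ *ℤ δ ∣ b ∣) (form k l a b)
  coefficient a b = trans (combine a b .at (ℕₚ.≤-refl {n})) (term-coeff n (ε ∣ a ∣ *ℤ δ ∣ b ∣) (form k l a b))

m≤m*m : ∀ m → m ≤ m * m
m≤m*m zero    = z≤n
m≤m*m (suc m) = ℕₚ.m≤m*n (suc m) (suc m)

form-boundˡ : ∀ k l .{{_ : NonZero k}} a b → ∣ a ∣ ≤ ∣ form k l a b ∣
form-boundˡ k l a b rewrite sym (∣form∣ k l a b) =
  ℕₚ.≤-trans (m≤m*m ∣ a ∣) (ℕₚ.≤-trans (ℕₚ.m≤n*m (∣ a ∣ * ∣ a ∣) k) (ℕₚ.m≤m+n _ _))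

form-boundʳ : ∀ k l .{{_ : NonZero l}} a b → ∣ b ∣ ≤ ∣ form k l a b ∣
form-boundʳ k l a b rewrite sym (∣form∣ k l a b) =
  ℕₚ.≤-trans (m≤m*m ∣ b ∣) (ℕₚ.≤-trans (ℕₚ.m≤n*m (∣ b ∣ * ∣ b ∣) l) (ℕₚ.m≤n+m _ _))

-- With k, l ≥ 1 each coordinate is bounded by the value of the form, so the box of radius N
-- contains every point that contributes to a coefficient of degree at most N.
form-support : ∀ k l .{{_ : NonZero k}} .{{_ : NonZero l}} {N n} → n ≤ N → ∀ w {a b} →
  term n w (form k l a b) ≢ + 0 → (a , b) ∈ box N
form-support k l {N} {n} n≤N w {a} {b} ≢0 = ∈-box N
  (ℕₚ.≤-trans (form-boundˡ k l a b) e≤N) (ℕₚ.≤-trans (form-boundʳ k l a b) e≤N)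
  where
  e≤N : ∣ form k l a b ∣ ≤ N
  e≤N = subst (_≤ N) (sym (term-exponent n w (form k l a b) ≢0)) n≤N

-- Parity of integers

sg : ℤ → ℤ
sg a = sign ∣ a ∣

sg-suc : ∀ a → sg (+ 1 +ℤ a) ≡ - sg a
sg-suc (+ n)          = refl
sg-suc -[1+ zero ]    = refl
sg-suc -[1+ suc n ]   = sym (ℤₚ.neg-involutive (sign (suc n)))

sg-neg : ∀ a → sg (- a) ≡ sg a
sg-neg a = cong sign (ℤₚ.∣-i∣≡∣i∣ a)

sg-+⁺ : ∀ n b → sg (+ n +ℤ b) ≡ sign n *ℤ sg b
sg-+⁺ zero    b = trans (cong sg (ℤₚ.+-identityˡ b)) (sym (ℤₚ.*-identityˡ (sg b)))
sg-+⁺ (suc n) b = begin≡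
  sg (+ suc n +ℤ b)          ≡⟨ cong sg (ℤₚ.+-assoc (+ 1) (+ n) b) ⟩
  sg (+ 1 +ℤ (+ n +ℤ b))     ≡⟨ sg-suc (+ n +ℤ b) ⟩
  - sg (+ n +ℤ b)            ≡⟨ cong -_ (sg-+⁺ n b) ⟩
  - (sign n *ℤ sg b)         ≡⟨ ℤₚ.neg-distribˡ-* (sign n) (sg b) ⟩
  sign (suc n) *ℤ sg b       ∎≡

sg-+ : ∀ a b → sg (a +ℤ b) ≡ sg a *ℤ sg b
sg-+ (+ n)    b = sg-+⁺ n b
sg-+ -[1+ n ] b = begin≡
  sg (-[1+ n ] +ℤ b)              ≡⟨ sg-neg (-[1+ n ] +ℤ b) ⟨
  sg (- (-[1+ n ] +ℤ b))          ≡⟨ cong sg (ℤₚ.neg-distrib-+ -[1+ n ] b) ⟩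
  sg (+ suc n +ℤ - b)             ≡⟨ sg-+⁺ (suc n) (- b) ⟩
  sign (suc n) *ℤ sg (- b)        ≡⟨ cong (sign (suc n) *ℤ_) (sg-neg b) ⟩
  sign (suc n) *ℤ sg b            ∎≡

sg-double : ∀ x → sg (x +ℤ x) ≡ + 1
sg-double x = trans (sg-+ x x) (sign-sq ∣ x ∣)

sg-2*+ : ∀ x y → sg (x +ℤ x +ℤ y) ≡ sg y
sg-2*+ x y = trans (sg-+ (x +ℤ x) y) (trans (cong (_*ℤ sg y) (sg-double x)) (ℤₚ.*-identityˡ (sg y)))

Parity : ℤ → Set
Parity a = (∃ λ x → a ≡ x +ℤ x) ⊎ (∃ λ x → a ≡ x +ℤ x +ℤ + 1)

parity-+ : ∀ n → Parity (+ n)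
parity-+ zero = inj₁ (+ 0 , refl)
parity-+ (suc n) with parity-+ n
... | inj₁ (x , n≡) = inj₂ (x , trans (ℤₚ.+-comm (+ 1) (+ n)) (cong (_+ℤ + 1) n≡))
... | inj₂ (x , n≡) = inj₁ (x +ℤ + 1 , trans (cong (+ 1 +ℤ_) n≡) (shift x))
  where
  shift : ∀ x → + 1 +ℤ (x +ℤ x +ℤ + 1) ≡ x +ℤ + 1 +ℤ (x +ℤ + 1)
  shift = ℤ-solve-∀

parity : ∀ a → Parity a
parity (+ n)    = parity-+ n
parity -[1+ n ] with parity-+ (suc n)
... | inj₁ (x , n≡) = inj₁ (- x , trans (cong -_ n≡) (ℤₚ.neg-distrib-+ x x))
... | inj₂ (x , n≡) = inj₂ (- x -ℤ + 1 , trans (cong -_ n≡) (negate x))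
  where
  negate : ∀ x → - (x +ℤ x +ℤ + 1) ≡ - x -ℤ + 1 +ℤ (- x -ℤ + 1) +ℤ + 1
  negate = ℤ-solve-∀

sg-even : ∀ {a} → (∃ λ x → a ≡ x +ℤ x) → sg a ≡ + 1
sg-even (x , refl) = sg-double x

sg-odd : ∀ {a} → (∃ λ x → a ≡ x +ℤ x +ℤ + 1) → sg a ≡ - + 1
sg-odd (x , refl) = sg-2*+ x (+ 1)

-- Supplies the preimages under the changes of variables below: signs of opposite parities cancel,
-- so a nonzero weight provides the half-difference that the inverse map requires.
same-parity : ∀ a b → sg a +ℤ sg b ≢ + 0 → ∃ λ x → a ≡ x +ℤ x +ℤ b
same-parity a b ≢0 with parity a | parity b
... | inj₁ (x , a≡) | inj₁ (y , b≡) = x -ℤ y , trans a≡ (trans (diff x y) (cong (x -ℤ y +ℤ (x -ℤ y) +ℤ_) (sym b≡)))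
  where
  diff : ∀ x y → x +ℤ x ≡ x -ℤ y +ℤ (x -ℤ y) +ℤ (y +ℤ y)
  diff = ℤ-solve-∀
... | inj₂ (x , a≡) | inj₂ (y , b≡) = x -ℤ y , trans a≡ (trans (diff x y) (cong (x -ℤ y +ℤ (x -ℤ y) +ℤ_) (sym b≡)))
  where
  diff : ∀ x y → x +ℤ x +ℤ + 1 ≡ x -ℤ y +ℤ (x -ℤ y) +ℤ (y +ℤ y +ℤ + 1)
  diff = ℤ-solve-∀
... | inj₁ a-even | inj₂ b-odd = contradiction (cong₂ _+ℤ_ (sg-even {a} a-even) (sg-odd {b} b-odd)) ≢0
... | inj₂ a-odd | inj₁ b-even = contradiction (cong₂ _+ℤ_ (sg-odd {a} a-odd) (sg-even {b} b-even)) ≢0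

double-injective : ∀ {x y} → x +ℤ x ≡ y +ℤ y → x ≡ y
double-injective {x} {y} x+x≡y+y = ℤₚ.*-cancelˡ-≡ (+ 2) x y (trans (double x) (trans x+x≡y+y (sym (double y))))
  where
  double : ∀ x → + 2 *ℤ x ≡ x +ℤ x
  double = ℤ-solve-∀

-- On the left (a, b) has weight 1 + (-1)^(a+b), which is 2 or 0. The surviving points, with a + b
-- even, are (x + y, x - y), and there a² + b² = 2(x² + y²).
landen : ∀ k .{{_ : NonZero k}} N → let t = θ trivial (2 * k) N in
  θ trivial k N · θ trivial k N ⊕ θ sign k N · θ sign k N ≈[ N ] t · t ⊕ t · t
landen k N .at {n} n≤N = begin≡
  (θ trivial k N · θ trivial k N ⊕ θ sign k N · θ sign k N) n
    ≡⟨ trans (⊕-coeff (θ trivial k N · θ trivial k N) (θ sign k N · θ sign k N) n)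
         (cong₂ _+ℤ_ (θ-product trivial trivial k k N n) (θ-product sign sign k k N n)) ⟩
  wsum (λ (a , b) → term n (+ 1) (form k k a b)) (box N)
    +ℤ wsum (λ (a , b) → term n (sg a *ℤ sg b) (form k k a b)) (box N)
    ≡⟨ wsum-+ (λ (a , b) → term n (+ 1) (form k k a b))
         (λ (a , b) → term n (sg a *ℤ sg b) (form k k a b)) (box N) ⟩
  wsum (λ (a , b) → term n (+ 1) (form k k a b) +ℤ term n (sg a *ℤ sg b) (form k k a b)) (box N)
    ≡⟨ wsum-cong (λ (a , b) → term-+ n (+ 1) (sg a *ℤ sg b) (form k k a b)) (box N) ⟩
  wsum (λ (a , b) → term n (+ 1 +ℤ sg a *ℤ sg b) (form k k a b)) (box N)
    ≡⟨ wsum-transfer (box-unique N) (box-unique N) T T-injective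
         (λ (x , y) → cong₂ (term n) (weight x y) (exponent x y))
         (λ {p} → form-support (2 * k) (2 * k) {{2k≢0}} {{2k≢0}} n≤N (+ 2) {proj₁ p} {proj₂ p})
         (λ {p} → form-support k k n≤N (+ 1 +ℤ sg (proj₁ p) *ℤ sg (proj₂ p)) {proj₁ p} {proj₂ p})
         T-surjective ⟨
  wsum (λ (x , y) → term n (+ 2) (form (2 * k) (2 * k) x y)) (box N)
    ≡⟨ wsum-cong (λ (x , y) → term-+ n (+ 1) (+ 1) (form (2 * k) (2 * k) x y)) (box N) ⟨
  wsum (λ (x , y) → term n (+ 1) (form (2 * k) (2 * k) x y) +ℤ term n (+ 1) (form (2 * k) (2 * k) x y)) (box N)
    ≡⟨ wsum-+ (λ (x , y) → term n (+ 1) (form (2 * k) (2 * k) x y))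
         (λ (x , y) → term n (+ 1) (form (2 * k) (2 * k) x y)) (box N) ⟨
  wsum (λ (x , y) → term n (+ 1) (form (2 * k) (2 * k) x y)) (box N)
    +ℤ wsum (λ (x , y) → term n (+ 1) (form (2 * k) (2 * k) x y)) (box N)
    ≡⟨ trans (⊕-coeff (t · t) (t · t) n)
         (cong₂ _+ℤ_ (θ-product trivial trivial (2 * k) (2 * k) N n)
                     (θ-product trivial trivial (2 * k) (2 * k) N n)) ⟨
  (t · t ⊕ t · t) n ∎≡
  where
  t = θ trivial (2 * k) N
  2k≢0 : NonZero (2 * k)
  2k≢0 = ℕₚ.m*n≢0 2 k
  T : ℤ × ℤ → ℤ × ℤ
  T (x , y) = x +ℤ y , x -ℤ y
  T-injective : ∀ {p q} → T p ≡ T q → p ≡ q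
  T-injective {x , y} {x′ , y′} Tp≡Tq with ,-injective Tp≡Tq
  ... | +≡ , -≡ = cong₂ _,_
    (double-injective (trans (recover x y) (trans (cong₂ _+ℤ_ +≡ -≡) (sym (recover x′ y′)))))
    (double-injective (trans (recover′ x y) (trans (cong₂ _-ℤ_ +≡ -≡) (sym (recover′ x′ y′)))))
    where
    recover : ∀ x y → x +ℤ x ≡ x +ℤ y +ℤ (x -ℤ y)
    recover = ℤ-solve-∀
    recover′ : ∀ x y → y +ℤ y ≡ x +ℤ y -ℤ (x -ℤ y)
    recover′ = ℤ-solve-∀
  exponent : ∀ x y → form (2 * k) (2 * k) x y ≡ form k k (x +ℤ y) (x -ℤ y)
  exponent x y = trans (cong (λ c → c *ℤ (x *ℤ x) +ℤ c *ℤ (y *ℤ y)) (ℤₚ.pos-* 2 k)) (identity (+ k) x y)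
    where
    identity : ∀ k x y → + 2 *ℤ k *ℤ (x *ℤ x) +ℤ + 2 *ℤ k *ℤ (y *ℤ y)
      ≡ k *ℤ ((x +ℤ y) *ℤ (x +ℤ y)) +ℤ k *ℤ ((x -ℤ y) *ℤ (x -ℤ y))
    identity = ℤ-solve-∀
  weight : ∀ x y → + 2 ≡ + 1 +ℤ sg (x +ℤ y) *ℤ sg (x -ℤ y)
  weight x y = cong (+ 1 +ℤ_) (sym (begin≡
    sg (x +ℤ y) *ℤ sg (x -ℤ y)   ≡⟨ sg-+ (x +ℤ y) (x -ℤ y) ⟨
    sg (x +ℤ y +ℤ (x -ℤ y))      ≡⟨ cong sg (sum x y) ⟩
    sg (x +ℤ x)                  ≡⟨ sg-double x ⟩
    + 1 ∎≡))
    where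
    sum : ∀ x y → x +ℤ y +ℤ (x -ℤ y) ≡ x +ℤ x
    sum = ℤ-solve-∀
  T-surjective : ∀ p → term n (+ 1 +ℤ sg (proj₁ p) *ℤ sg (proj₂ p)) (form k k (proj₁ p) (proj₂ p)) ≢ + 0 →
                 ∃ λ q → p ≡ T q
  -- Comparing a + b with 0 says that a + b = 2x is even, whence y = x - b.
  T-surjective (a , b) ≢0 with same-parity (a +ℤ b) (+ 0) parity≢0
    where
    parity≢0 : sg (a +ℤ b) +ℤ + 1 ≢ + 0
    parity≢0 ≡0 = term-weight n (form k k a b) ≢0
      (trans (ℤₚ.+-comm (+ 1) (sg a *ℤ sg b)) (trans (cong (_+ℤ + 1) (sym (sg-+ a b))) ≡0))
  ... | x , a+b≡ = (x , x -ℤ b) , cong₂ _,_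
      (trans (solve-a a b) (trans (cong (_-ℤ b) a+b≡) (assoc x b))) (solve-b x b)
    where
    solve-a : ∀ a b → a ≡ a +ℤ b -ℤ b
    solve-a = ℤ-solve-∀
    assoc : ∀ x b → x +ℤ x +ℤ + 0 -ℤ b ≡ x +ℤ (x -ℤ b)
    assoc = ℤ-solve-∀
    solve-b : ∀ x b → b ≡ x -ℤ (x -ℤ b)
    solve-b = ℤ-solve-∀

-- Four times the norm form x² + xy + y² of the hexagonal lattice, which contains
-- the points of a² + 3b² with a ≡ b (mod 2) and is symmetric under x ↔ y and x ↦ -x-y.
hexagonal : ℤ → ℤ → ℤ
hexagonal x y = + 4 *ℤ (x *ℤ x +ℤ x *ℤ y +ℤ y *ℤ y)

hexagonal-form : ∀ x y → hexagonal x y ≡ form 1 3 (x +ℤ x +ℤ y) y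
hexagonal-form = identity
  where
  identity : ∀ x y → + 4 *ℤ (x *ℤ x +ℤ x *ℤ y +ℤ y *ℤ y)
    ≡ + 1 *ℤ ((x +ℤ x +ℤ y) *ℤ (x +ℤ x +ℤ y)) +ℤ + 3 *ℤ (y *ℤ y)
  identity = ℤ-solve-∀

hexagonal-swap : ∀ x y → hexagonal x y ≡ hexagonal y x
hexagonal-swap = identity
  where
  identity : ∀ x y → + 4 *ℤ (x *ℤ x +ℤ x *ℤ y +ℤ y *ℤ y) ≡ + 4 *ℤ (y *ℤ y +ℤ y *ℤ x +ℤ x *ℤ x)
  identity = ℤ-solve-∀

hexagonal-rotate : ∀ x y → hexagonal x y ≡ hexagonal (- (x +ℤ y)) y
hexagonal-rotate = identity
  where
  identity : ∀ x y → + 4 *ℤ (x *ℤ x +ℤ x *ℤ y +ℤ y *ℤ y)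
    ≡ + 4 *ℤ (- (x +ℤ y) *ℤ - (x +ℤ y) +ℤ - (x +ℤ y) *ℤ y +ℤ y *ℤ y)
  identity = ℤ-solve-∀

hexagonal-even : ∀ u v → form 4 12 u v ≡ hexagonal (u -ℤ v) (v +ℤ v)
hexagonal-even = identity
  where
  identity : ∀ u v → + 4 *ℤ (u *ℤ u) +ℤ + 12 *ℤ (v *ℤ v)
    ≡ + 4 *ℤ ((u -ℤ v) *ℤ (u -ℤ v) +ℤ (u -ℤ v) *ℤ (v +ℤ v) +ℤ (v +ℤ v) *ℤ (v +ℤ v))
  identity = ℤ-solve-∀

hexagonal-bound : ∀ x y → ∣ y ∣ ≤ ∣ hexagonal x y ∣
hexagonal-bound x y rewrite hexagonal-form x y = form-boundʳ 1 3 (x +ℤ x +ℤ y) y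

hexagonal-support : ∀ {N n} → n ≤ N → ∀ w {x y} → term n w (hexagonal x y) ≢ + 0 → (x , y) ∈ box N
hexagonal-support {N} {n} n≤N w {x} {y} ≢0 = ∈-box N
  (ℕₚ.≤-trans (hexagonal-bound y x) (subst (_≤ N) (cong ∣_∣ (hexagonal-swap x y)) e≤N))
  (ℕₚ.≤-trans (hexagonal-bound x y) e≤N)
  where
  e≤N : ∣ hexagonal x y ∣ ≤ N
  e≤N = subst (_≤ N) (sym (term-exponent n w (hexagonal x y) ≢0)) n≤N

module Hexagonal {N n} (n≤N : n ≤ N) where

  hexSum : (ℤ → ℤ → ℤ) → ℤ
  hexSum w = wsum (λ (x , y) → term n (w x y) (hexagonal x y)) (box N)

  hexSum-+ : ∀ w w′ → hexSum w +ℤ hexSum w′ ≡ hexSum (λ x y → w x y +ℤ w′ x y)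
  hexSum-+ w w′ = trans
    (wsum-+ (λ (x , y) → term n (w x y) (hexagonal x y)) (λ (x , y) → term n (w′ x y) (hexagonal x y)) (box N))
    (wsum-cong (λ (x , y) → term-+ n (w x y) (w′ x y) (hexagonal x y)) (box N))

  hexSum-supp : ∀ (w : ℤ → ℤ → ℤ) {p} → term n (w (proj₁ p) (proj₂ p)) (hexagonal (proj₁ p) (proj₂ p)) ≢ + 0 → p ∈ box N
  hexSum-supp w {x , y} = hexagonal-support n≤N (w x y)

  -- The weight vanishes unless a and b have the same parity. Then b = y and a = 2x + y, both signs
  -- equal (-1)^y, and a² + 3b² becomes the hexagonal form.
  rectangular : wsum (λ (a , b) → term n (sg a +ℤ sg b) (form 1 3 a b)) (box N)
              ≡ hexSum (λ x y → sg y +ℤ sg y)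
  rectangular = sym (wsum-transfer (box-unique N) (box-unique N) T T-injective
      (λ (x , y) → cong₂ (term n) (cong (_+ℤ sg y) (sym (sg-2*+ x y))) (hexagonal-form x y))
      (λ {p} → hexSum-supp (λ x y → sg y +ℤ sg y) {p})
      (λ {p} → form-support 1 3 n≤N (sg (proj₁ p) +ℤ sg (proj₂ p)) {proj₁ p} {proj₂ p})
      λ (a , b) ≢0 → let x , a≡ = same-parity a b (term-weight n (form 1 3 a b) ≢0)
                     in (x , b) , cong (_, b) a≡)
    where
    T : ℤ × ℤ → ℤ × ℤ
    T (x , y) = x +ℤ x +ℤ y , y
    T-injective : ∀ {p q} → T p ≡ T q → p ≡ q
    T-injective {x , y} {x′ , y′} Tp≡Tq with ,-injective Tp≡Tq
    ... | x≡ , refl = cong (_, y) (double-injective (+-cancelʳ y (x +ℤ x) (x′ +ℤ x′) x≡))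

  swap : hexSum (λ x y → sg y +ℤ sg y) ≡ hexSum (λ x y → sg x +ℤ sg x)
  swap = wsum-transfer (box-unique N) (box-unique N) (λ (x , y) → y , x)
    (λ eq → cong (λ (x , y) → y , x) eq)
    (λ (x , y) → cong (term n _) (hexagonal-swap x y))
    (λ {p} → hexSum-supp (λ x y → sg y +ℤ sg y) {p})
    (λ {p} → hexSum-supp (λ x y → sg x +ℤ sg x) {p})
    (λ (x , y) _ → (y , x) , refl)

  -- The reflection that fixes y and sends x to -(x + y) preserves the form, is its own inverse, and
  -- turns the sign of x + y into that of the new x.
  rotate : hexSum (λ x y → sg (x +ℤ y)) ≡ hexSum (λ x y → sg x)
  rotate = wsum-transfer (box-unique N) (box-unique N) T
    (λ {p} {q} eq → trans (sym (involutive p)) (trans (cong T eq) (involutive q)))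
    (λ (x , y) → cong₂ (term n) (sym (sg-neg (x +ℤ y))) (hexagonal-rotate x y))
    (λ {p} → hexSum-supp (λ x y → sg (x +ℤ y)) {p})
    (λ {p} → hexSum-supp (λ x y → sg x) {p})
    (λ p _ → T p , sym (involutive p))
    where
    T : ℤ × ℤ → ℤ × ℤ
    T (x , y) = - (x +ℤ y) , y
    involutive : ∀ p → T (T p) ≡ p
    involutive (x , y) = cong (_, y) (identity x y)
      where
      identity : ∀ x y → - (- (x +ℤ y) +ℤ y) ≡ x
      identity = ℤ-solve-∀

  -- Only even y = 2v survive on the right. With x = u - v, the numbers x and x + y = u + v share
  -- the sign (-1)^(u+v), and x² + xy + y² = u² + 3v².
  even : wsum (λ (u , v) → term n (sg u *ℤ sg v +ℤ sg u *ℤ sg v) (form 4 12 u v)) (box N)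
       ≡ hexSum (λ x y → sg x +ℤ sg (x +ℤ y))
  even = wsum-transfer (box-unique N) (box-unique N) T T-injective
      (λ (u , v) → cong₂ (term n) (weight u v) (hexagonal-even u v))
      (λ {p} → form-support 4 12 n≤N (sg (proj₁ p) *ℤ sg (proj₂ p) +ℤ sg (proj₁ p) *ℤ sg (proj₂ p)) {proj₁ p} {proj₂ p})
      (λ {p} → hexSum-supp (λ x y → sg x +ℤ sg (x +ℤ y)) {p})
      T-surjective
    where
    T : ℤ × ℤ → ℤ × ℤ
    T (u , v) = u -ℤ v , v +ℤ v
    T-injective : ∀ {p q} → T p ≡ T q → p ≡ q
    T-injective {u , v} {u′ , v′} Tp≡Tq with ,-injective Tp≡Tq
    ... | u≡ , v≡ with double-injective {v} {v′} v≡
    ... | refl = cong (_, v) (+-cancelʳ (- v) u u′ u≡)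
    sg-minus : ∀ u v → sg (u -ℤ v) ≡ sg u *ℤ sg v
    sg-minus u v = trans (sg-+ u (- v)) (cong (sg u *ℤ_) (sg-neg v))
    weight : ∀ u v → sg u *ℤ sg v +ℤ sg u *ℤ sg v ≡ sg (u -ℤ v) +ℤ sg (u -ℤ v +ℤ (v +ℤ v))
    weight u v = sym (cong₂ _+ℤ_ (sg-minus u v)
      (trans (sg-+ (u -ℤ v) (v +ℤ v)) (trans (cong (sg (u -ℤ v) *ℤ_) (sg-double v))
        (trans (ℤₚ.*-identityʳ (sg (u -ℤ v))) (sg-minus u v)))))
    T-surjective : ∀ p → term n (sg (proj₁ p) +ℤ sg (proj₁ p +ℤ proj₂ p)) (hexagonal (proj₁ p) (proj₂ p)) ≢ + 0 →
                   ∃ λ q → p ≡ T q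
    T-surjective (x , y) ≢0 with same-parity (x +ℤ y) x
      (λ ≡0 → term-weight n (hexagonal x y) ≢0 (trans (ℤₚ.+-comm (sg x) _) ≡0))
    ... | v , x+y≡ = (x +ℤ v , v) , cong₂ _,_ (solve-x x v)
        (trans (solve-y x y) (trans (cong (_-ℤ x) x+y≡) (cancel v x)))
      where
      solve-x : ∀ x v → x ≡ x +ℤ v -ℤ v
      solve-x = ℤ-solve-∀
      solve-y : ∀ x y → y ≡ x +ℤ y -ℤ x
      solve-y = ℤ-solve-∀
      cancel : ∀ v x → v +ℤ v +ℤ x -ℤ x ≡ v +ℤ v
      cancel = ℤ-solve-∀

  -- The weights (-1)^y, (-1)^x and (-1)^(x+y) have equal sums over the hexagonal lattice,
  -- and (-1)^x + (-1)^(x+y) vanishes for odd y.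
  rectangular-even : wsum (λ (a , b) → term n (sg a +ℤ sg b) (form 1 3 a b)) (box N)
    ≡ wsum (λ (u , v) → term n (sg u *ℤ sg v +ℤ sg u *ℤ sg v) (form 4 12 u v)) (box N)
  rectangular-even = begin≡
    wsum (λ (a , b) → term n (sg a +ℤ sg b) (form 1 3 a b)) (box N)
      ≡⟨ trans rectangular swap ⟩
    hexSum (λ x y → sg x +ℤ sg x)
      ≡⟨ hexSum-+ (λ x y → sg x) (λ x y → sg x) ⟨
    hexSum (λ x y → sg x) +ℤ hexSum (λ x y → sg x)
      ≡⟨ cong (hexSum (λ x y → sg x) +ℤ_) rotate ⟨
    hexSum (λ x y → sg x) +ℤ hexSum (λ x y → sg (x +ℤ y))
      ≡⟨ hexSum-+ (λ x y → sg x) (λ x y → sg (x +ℤ y)) ⟩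
    hexSum (λ x y → sg x +ℤ sg (x +ℤ y))
      ≡⟨ even ⟨
    wsum (λ (u , v) → term n (sg u *ℤ sg v +ℤ sg u *ℤ sg v) (form 4 12 u v)) (box N) ∎≡

-- In classical notation φ(-q) φ(q³) + φ(q) φ(-q³) = 2 φ(-q⁴) φ(-q¹²). The left side weights a² +
-- 3b² by (-1)^a + (-1)^b, which confines it to the hexagonal lattice.
hexagonal-theta : ∀ N → let t = θ sign 4 N · θ sign 12 N in
  θ sign 1 N · θ trivial 3 N ⊕ θ trivial 1 N · θ sign 3 N ≈[ N ] t ⊕ t
hexagonal-theta N .at {n} n≤N = begin≡
  (θ sign 1 N · θ trivial 3 N ⊕ θ trivial 1 N · θ sign 3 N) n
    ≡⟨ trans (⊕-coeff (θ sign 1 N · θ trivial 3 N) (θ trivial 1 N · θ sign 3 N) n)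
         (cong₂ _+ℤ_ (θ-product sign trivial 1 3 N n) (θ-product trivial sign 1 3 N n)) ⟩
  wsum (λ (a , b) → term n (sg a *ℤ + 1) (form 1 3 a b)) (box N)
    +ℤ wsum (λ (a , b) → term n (+ 1 *ℤ sg b) (form 1 3 a b)) (box N)
    ≡⟨ wsum-+ (λ (a , b) → term n (sg a *ℤ + 1) (form 1 3 a b))
         (λ (a , b) → term n (+ 1 *ℤ sg b) (form 1 3 a b)) (box N) ⟩
  wsum (λ (a , b) → term n (sg a *ℤ + 1) (form 1 3 a b) +ℤ term n (+ 1 *ℤ sg b) (form 1 3 a b)) (box N)
    ≡⟨ wsum-cong (λ (a , b) → trans (term-+ n (sg a *ℤ + 1) (+ 1 *ℤ sg b) (form 1 3 a b))
         (cong (λ w → term n w (form 1 3 a b)) (cong₂ _+ℤ_ (ℤₚ.*-identityʳ (sg a)) (ℤₚ.*-identityˡ (sg b)))))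
         (box N) ⟩
  wsum (λ (a , b) → term n (sg a +ℤ sg b) (form 1 3 a b)) (box N)
    ≡⟨ Hexagonal.rectangular-even n≤N ⟩
  wsum (λ (u , v) → term n (sg u *ℤ sg v +ℤ sg u *ℤ sg v) (form 4 12 u v)) (box N)
    ≡⟨ wsum-cong (λ (u , v) → term-+ n (sg u *ℤ sg v) (sg u *ℤ sg v) (form 4 12 u v)) (box N) ⟨
  wsum (λ (u , v) → term n (sg u *ℤ sg v) (form 4 12 u v) +ℤ term n (sg u *ℤ sg v) (form 4 12 u v)) (box N)
    ≡⟨ wsum-+ (λ (u , v) → term n (sg u *ℤ sg v) (form 4 12 u v))
         (λ (u , v) → term n (sg u *ℤ sg v) (form 4 12 u v)) (box N) ⟨
  wsum (λ (u , v) → term n (sg u *ℤ sg v) (form 4 12 u v)) (box N)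
    +ℤ wsum (λ (u , v) → term n (sg u *ℤ sg v) (form 4 12 u v)) (box N)
    ≡⟨ trans (⊕-coeff t t n) (cong₂ _+ℤ_ (θ-product sign sign 4 12 N n) (θ-product sign sign 4 12 N n)) ⟨
  (t ⊕ t) n ∎≡
  where
  t = θ sign 4 N · θ sign 12 N

-- Cancellation

·-cancel-unit : ∀ {N f g h} x → x · h ≈[ N ] 𝟏 → f · h ≈[ N ] g · h → f ≈[ N ] g
·-cancel-unit {f = f} {g} {h} x xh≈1 fh≈gh = begin
  f              ≈⟨ expand f ⟩
  f · h · x      ≈⟨ ·-congʳ x fh≈gh ⟩
  g · h · x      ≈⟨ expand g ⟨
  g              ∎
  where
  expand : ∀ f → f ≈[ _ ] f · h · x
  expand f = begin
    f              ≈⟨ ·-identityʳ f ⟨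
    f · 𝟏          ≈⟨ ·-congˡ f xh≈1 ⟨
    f · (x · h)    ≈⟨ solve 3 (λ f x h → f :* (x :* h) := f :* h :* x) ≈-refl f x h ⟩
    f · h · x      ∎

·-integral₀ : ∀ {N f g} → f 0 ≢ + 0 → f · g ≈[ N ] const (+ 0) → g ≈[ N ] const (+ 0)
·-integral₀ {N} {f} {g} f₀≢0 fg≈0 .at {n} n≤N = trans (<-rec (λ n → n ≤ N → g n ≡ + 0) step n n≤N) (sym (const-0 n))
  where
  step : ∀ n → (∀ {k} → k < n → k ≤ N → g k ≡ + 0) → n ≤ N → g n ≡ + 0
  step n rec n≤N with ℤₚ.i*j≡0⇒i≡0∨j≡0 (f 0) f₀gₙ≡0
    where
    others : ∀ {k} → k ≤ n → k ≢ 0 → f k *ℤ g (n ∸ k) ≡ + 0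
    others {zero}  _   0≢0 = contradiction refl 0≢0
    others {suc k} k<n _   = trans (cong (f (suc k) *ℤ_)
      (rec (ℕₚ.∸-monoʳ-< (s≤s z≤n) k<n) (ℕₚ.≤-trans (ℕₚ.m∸n≤m n (suc k)) n≤N))) (ℤₚ.*-zeroʳ (f (suc k)))
    f₀gₙ≡0 : f 0 *ℤ g n ≡ + 0
    f₀gₙ≡0 = trans (sym (sumTo-single n 0 z≤n others))
      (trans (sym (·-coeff f g n)) (trans (fg≈0 .at n≤N) (const-0 n)))
  ... | inj₁ f₀≡0 = contradiction f₀≡0 f₀≢0
  ... | inj₂ gₙ≡0 = gₙ≡0

-- Here `f` has a simple zero at q = 0. Dividing by q costs one order of precision, hence `suc N` in
-- the hypothesis and `N` in the conclusion.
·-integral₁ : ∀ {N f g} → f 0 ≡ + 0 → f 1 ≢ + 0 → f · g ≈[ suc N ] const (+ 0) → g ≈[ N ] const (+ 0)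
·-integral₁ {N} {f} {g} f₀≡0 f₁≢0 fg≈0 = ·-integral₀ {f = tail f} f₁≢0 tail≈0
  where
  tail≈0 : tail f · g ≈[ N ] const (+ 0)
  tail≈0 .at {n} n≤N = begin≡
    (tail f · g) n                              ≡⟨ ℤₚ.+-identityˡ _ ⟨
    + 0 *ℤ g (suc n) +ℤ (tail f · g) n          ≡⟨ cong (λ c → c *ℤ g (suc n) +ℤ (tail f · g) n) f₀≡0 ⟨
    f 0 *ℤ g (suc n) +ℤ (tail f · g) n          ≡⟨ ·-suc f g n ⟨
    (f · g) (suc n)                             ≡⟨ fg≈0 .at (s≤s n≤N) ⟩
    + 0                                         ≡⟨ const-0 n ⟨
    const (+ 0) n                               ∎≡


-- The modular equation of degree three

-- The series φ(-q^(2k)) = B_k φ(-q^k) is even in q. Applying q ↦ -q also writes it as φ(q^k) / B_k,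
-- and the two expressions are compared.
θ-trivial : ∀ k .{{_ : NonZero k}} N → sign k ≡ - + 1 →
            let u = oddRatios k N in θ trivial k N ≈[ N ] u · u · θ sign k N
θ-trivial k N odd = begin
  θ trivial k N                  ≈⟨ neg-θ k N odd ⟨
  neg t                          ≈⟨ ·-identityˡ (neg t) ⟨
  𝟏 · neg t                      ≈⟨ ·-congʳ (neg t) (oddRatios-neg k N odd) ⟨
  u · neg u · neg t              ≈⟨ ·-assoc u (neg u) (neg t) ⟩
  u · (neg u · neg t)            ≈⟨ ·-congˡ u (neg-· u t) ⟨
  u · neg (u · t)                ≈⟨ ·-congˡ u (neg-cong (θ-dilation k N)) ⟨
  u · neg (dil t)                ≈⟨ ·-congˡ u (neg-dil t) ⟩
  u · dil t                      ≈⟨ ·-congˡ u (θ-dilation k N) ⟩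
  u · (u · t)                    ≈⟨ ·-assoc u u t ⟨
  u · u · t                      ∎
  where
  u = oddRatios k N
  t = θ sign k N

-- `landen` divided by φ(-q^k)² and multiplied by u². The extra u² makes the right side depend on u
-- and u' only through s = u u', the combination that occurs in `mixed-equation`.
quadratic-equation : ∀ k .{{_ : NonZero k}} N → sign k ≡ - + 1 →
  let u = oddRatios k N; s = u · dil u in
  u · u · (u · u · (u · u) ⊕ 𝟏) ≈[ N ] const (+ 2) · (s · s · (s · s))
quadratic-equation k N odd = ·-cancel-unit (g · g) unit (begin
  u · u · (u · u · (u · u) ⊕ 𝟏) · (t · t)
    ≈⟨ solve 2 (λ u t → u :* u :* (u :* u :* (u :* u) :+ con (+ 1)) :* (t :* t)
                     := u :* u :* ((u :* u :* t) :* (u :* u :* t) :+ t :* t)) ≈-refl u t ⟩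
  u · u · ((u · u · t) · (u · u · t) ⊕ t · t)
    ≈⟨ ·-congˡ (u · u) (⊕-cong (·-cong (θ-trivial k N odd) (θ-trivial k N odd)) ≈-refl) ⟨
  u · u · (θ trivial k N · θ trivial k N ⊕ t · t)
    ≈⟨ ·-congˡ (u · u) (landen k N) ⟩
  u · u · (θ trivial (2 * k) N · θ trivial (2 * k) N ⊕ θ trivial (2 * k) N · θ trivial (2 * k) N)
    ≈⟨ ·-congˡ (u · u) (⊕-cong (·-cong dilated dilated) (·-cong dilated dilated)) ⟩
  u · u · ((u′ · u′ · (u · t)) · (u′ · u′ · (u · t)) ⊕ (u′ · u′ · (u · t)) · (u′ · u′ · (u · t)))
    ≈⟨ solve 3 (λ u u′ t → let d = u′ :* u′ :* (u :* t); s = u :* u′ in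
         u :* u :* (d :* d :+ d :* d) := con (+ 2) :* (s :* s :* (s :* s)) :* (t :* t)) ≈-refl u u′ t ⟩
  const (+ 2) · (u · u′ · (u · u′) · (u · u′ · (u · u′))) · (t · t) ∎)
  where
  u = oddRatios k N
  u′ = dil u
  t = θ sign k N
  g = ratios k N
  unit : g · g · (t · t) ≈[ N ] 𝟏
  unit = ≈-trans (solve 2 (λ g t → g :* g :* (t :* t) := g :* t :* (g :* t)) ≈-refl g t)
    (≈-trans (·-cong (theta-product k N) (theta-product k N)) (·-identityˡ 𝟏))
  dilated : θ trivial (2 * k) N ≈[ N ] u′ · u′ · (u · t)
  dilated = begin
    θ trivial (2 * k) N        ≈⟨ dil-θ trivial k N ⟨
    dil (θ trivial k N)        ≈⟨ dil-cong (θ-trivial k N odd) ⟩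
    dil (u · u · t)            ≈⟨ dil-· (u · u) t ⟩
    dil (u · u) · dil t        ≈⟨ ·-cong (dil-· u u) (θ-dilation k N) ⟩
    u′ · u′ · (u · t)          ∎

-- Two uses of `θ-dilation`, one of them carried along q ↦ q², which is where the factor `dil u`
-- comes from.
θ-quadruple : ∀ k .{{_ : NonZero k}} N → let u = oddRatios k N in
              θ sign (2 * (2 * k)) N ≈[ N ] u · dil u · θ sign k N
θ-quadruple k N = begin
  θ sign (2 * (2 * k)) N     ≈⟨ dil-θ sign (2 * k) N ⟨
  dil (θ sign (2 * k) N)     ≈⟨ dil-cong (dil-θ sign k N) ⟨
  dil (dil t)                ≈⟨ dil-cong (θ-dilation k N) ⟩
  dil (u · t)                ≈⟨ dil-· u t ⟩
  dil u · dil t              ≈⟨ ·-congˡ (dil u) (θ-dilation k N) ⟩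
  dil u · (u · t)            ≈⟨ solve 3 (λ u u′ t → u′ :* (u :* t) := u :* u′ :* t) ≈-refl u (dil u) t ⟩
  u · dil u · t              ∎
  where
  u = oddRatios k N
  t = θ sign k N

module _ (N : ℕ) where

  private
    u = oddRatios 1 N
    v = oddRatios 3 N
    s = u · dil u
    t = v · dil v

  -- `hexagonal-theta` divided by φ(-q) φ(-q³), whose inverse is `ratios 1 N · ratios 3 N` by Gauss.
  mixed-equation : u · u ⊕ v · v ≈[ N ] const (+ 2) · (s · t)
  mixed-equation = ·-cancel-unit (ratios 1 N · ratios 3 N) unit (begin
    (u · u ⊕ v · v) · (p · r)
      ≈⟨ solve 4 (λ u v p r → (u :* u :+ v :* v) :* (p :* r)
                           := p :* (v :* v :* r) :+ (u :* u :* p) :* r) ≈-refl u v p r ⟩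
    p · (v · v · r) ⊕ (u · u · p) · r
      ≈⟨ ⊕-cong (·-congˡ p (θ-trivial 3 N refl)) (·-congʳ r (θ-trivial 1 N refl)) ⟨
    p · θ trivial 3 N ⊕ θ trivial 1 N · r
      ≈⟨ hexagonal-theta N ⟩
    θ sign 4 N · θ sign 12 N ⊕ θ sign 4 N · θ sign 12 N
      ≈⟨ ⊕-cong (·-cong (θ-quadruple 1 N) (θ-quadruple 3 N)) (·-cong (θ-quadruple 1 N) (θ-quadruple 3 N)) ⟩
    s · p · (t · r) ⊕ s · p · (t · r)
      ≈⟨ solve 4 (λ s p t r → s :* p :* (t :* r) :+ s :* p :* (t :* r)
                           := con (+ 2) :* (s :* t) :* (p :* r)) ≈-refl s p t r ⟩
    const (+ 2) · (s · t) · (p · r) ∎)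
    where
    p = θ sign 1 N
    r = θ sign 3 N
    unit : ratios 1 N · ratios 3 N · (p · r) ≈[ N ] 𝟏
    unit = ≈-trans
      (solve 4 (λ g h p r → g :* h :* (p :* r) := g :* p :* (h :* r)) ≈-refl (ratios 1 N) (ratios 3 N) p r)
      (≈-trans (·-cong (theta-product 1 N) (theta-product 3 N)) (·-identityˡ 𝟏))

  private
    lhs = u · u · (u · u) ⊕ ⊖ (v · v · (v · v))
    rhs = const (+ 2) · (u · v) · (u · u · (v · v) ⊕ ⊖ 𝟏)

  -- lhs = rhs is the modular equation of degree three; its square follows from the
  -- fourth power of the mixed equation together with the two quadratic ones.
  modular-equation-squared : (lhs ⊕ rhs) · (lhs ⊕ ⊖ rhs) ≈[ N ] const (+ 0)
  modular-equation-squared = begin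
    (lhs ⊕ rhs) · (lhs ⊕ ⊖ rhs)
      -- With a = u² and b = v² the product is (a + b)⁴ - 4 a(a² + 1) b(b² + 1); the equations above
      -- make both terms equal to 16 s⁴ t⁴.
      ≈⟨ solve 2 (λ u v → let o = con (+ 1); a = u :* u; b = v :* v
                              l = a :* a :+ :- (b :* b); r = con (+ 2) :* (u :* v) :* (a :* b :+ :- o) in
           (l :+ r) :* (l :+ :- r)
           := (a :+ b) :* (a :+ b) :* ((a :+ b) :* (a :+ b))
              :+ :- (con (+ 4) :* ((a :* (a :* a :+ o)) :* (b :* (b :* b :+ o))))) ≈-refl u v ⟩
    (u · u ⊕ v · v) · (u · u ⊕ v · v) · ((u · u ⊕ v · v) · (u · u ⊕ v · v))
      ⊕ ⊖ (const (+ 4) · (u · u · (u · u · (u · u) ⊕ 𝟏) · (v · v · (v · v · (v · v) ⊕ 𝟏))))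
      ≈⟨ ⊕-cong (·-cong (·-cong mixed-equation mixed-equation) (·-cong mixed-equation mixed-equation))
           (⊖-cong (·-congˡ (const (+ 4))
             (·-cong (quadratic-equation 1 N refl) (quadratic-equation 3 N refl)))) ⟩
    const (+ 2) · (s · t) · (const (+ 2) · (s · t)) · (const (+ 2) · (s · t) · (const (+ 2) · (s · t)))
      ⊕ ⊖ (const (+ 4) · (const (+ 2) · (s · s · (s · s)) · (const (+ 2) · (t · t · (t · t)))))
      ≈⟨ solve 2 (λ s t → let two = con (+ 2); w = two :* (s :* t) in
           w :* w :* (w :* w)
             :+ :- (con (+ 4) :* (two :* (s :* s :* (s :* s)) :* (two :* (t :* t :* (t :* t)))))
           := con (+ 0)) ≈-refl s t ⟩
    const (+ 0) ∎

  -- From u = 1 + 2q + ... and v = 1 + O(q³), both u⁴ - v⁴ and 2uv(u²v² - 1) begin with 8q. Their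
  -- sum therefore begins with 16q, which decides the sign.
  leading-term : 1 ≤ N → lhs ⊕ rhs ≈[ 1 ] const (+ 16) · mono 1
  leading-term 1≤N = begin
    lhs ⊕ rhs
      ≈⟨ ⊕-cong (⊕-cong (·-cong (·-cong u≈ u≈) (·-cong u≈ u≈)) (⊖-cong (·-cong (·-cong v≈ v≈) (·-cong v≈ v≈))))
           (·-cong (·-congˡ (const (+ 2)) (·-cong u≈ v≈))
             (⊕-cong (·-cong (·-cong u≈ u≈) (·-cong v≈ v≈)) ≈-refl)) ⟩
    U · U · (U · U) ⊕ ⊖ (𝟏 · 𝟏 · (𝟏 · 𝟏)) ⊕ const (+ 2) · (U · 𝟏) · (U · U · (𝟏 · 𝟏) ⊕ ⊖ 𝟏)
      ≈⟨ solve 1 (λ x → let o = con (+ 1); a = o :+ con (+ 2) :* x in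
           a :* a :* (a :* a) :+ :- (o :* o :* (o :* o)) :+ con (+ 2) :* (a :* o) :* (a :* a :* (o :* o) :+ :- o)
           := con (+ 16) :* x :+ (con (+ 48) :+ con (+ 48) :* x :+ con (+ 16) :* (x :* x)) :* (x :* x)) ≈-refl x ⟩
    const (+ 16) · x ⊕ c · (x · x)       ≈⟨ ⊕-cong ≈-refl (·-congˡ c x²≈0) ⟩
    const (+ 16) · x ⊕ c · const (+ 0)
      ≈⟨ solve 2 (λ y c → y :+ c :* con (+ 0) := y) ≈-refl (const (+ 16) · x) c ⟩
    const (+ 16) · x ∎
    where
    x = mono 1
    U = 𝟏 ⊕ const (+ 2) · x
    c = const (+ 48) ⊕ const (+ 48) · x ⊕ const (+ 16) · (x · x)
    x²≈0 : x · x ≈[ 1 ] const (+ 0)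
    x²≈0 = ≈-trans (mono-· 1 1) (mono-high (s≤s (s≤s z≤n)))
    geom≈ : geom (+ 1) 1 ≈[ 1 ] 𝟏 ⊕ x
    geom≈ .at z≤n       = sym (⊕-coeff 𝟏 x 0)
    geom≈ .at (s≤s z≤n) = sym (⊕-coeff 𝟏 x 1)
    u≈ : u ≈[ 1 ] U
    u≈ = begin
      u                          ≈⟨ oddRatios-stable 1 (s≤s z≤n) 1≤N ⟩
      𝟏 · ((𝟏 ⊕ x) · geom (+ 1) 1)    ≈⟨ ·-congˡ 𝟏 (·-congˡ (𝟏 ⊕ x) geom≈) ⟩
      𝟏 · ((𝟏 ⊕ x) · (𝟏 ⊕ x))
        ≈⟨ solve 1 (λ x → con (+ 1) :* ((con (+ 1) :+ x) :* (con (+ 1) :+ x))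
                       := con (+ 1) :+ con (+ 2) :* x :+ x :* x) ≈-refl x ⟩
      U ⊕ x · x                  ≈⟨ ⊕-cong ≈-refl x²≈0 ⟩
      U ⊕ const (+ 0)            ≈⟨ ⊕-zeroʳ U ⟩
      U                          ∎
    v≈ : v ≈[ 1 ] 𝟏
    v≈ = begin
      v                ≈⟨ oddRatios-stable 3 (s≤s z≤n) 1≤N ⟩
      𝟏 · ratio 3      ≈⟨ ·-congˡ 𝟏 (ratio-high (s≤s (s≤s z≤n))) ⟩
      𝟏 · 𝟏            ≈⟨ ·-identityˡ 𝟏 ⟩
      𝟏                ∎

  -- `lhs ⊕ rhs` has a simple zero at q = 0, so it can be cancelled from the product by
  -- `·-integral₁`; the order drops from N to M.
  modular-equation : ∀ {M} → N ≡ suc M → lhs ≈[ M ] rhs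
  modular-equation {M} refl = begin
    lhs                      ≈⟨ solve 2 (λ l r → l := r :+ (l :+ :- r)) ≈-refl lhs rhs ⟩
    rhs ⊕ (lhs ⊕ ⊖ rhs)      ≈⟨ ⊕-cong ≈-refl (·-integral₁ {f = lhs ⊕ rhs} coeff₀ coeff₁ modular-equation-squared) ⟩
    rhs ⊕ const (+ 0)        ≈⟨ ⊕-zeroʳ rhs ⟩
    rhs                      ∎
    where
    coeff₀ : (lhs ⊕ rhs) 0 ≡ + 0
    coeff₀ = trans (leading-term (s≤s z≤n) .at z≤n) (const-· (+ 16) (mono 1) 0)
    coeff₁ : (lhs ⊕ rhs) 1 ≢ + 0
    coeff₁ ≡0 with trans (sym (const-· (+ 16) (mono 1) 1)) (trans (sym (leading-term (s≤s z≤n) .at (s≤s z≤n))) ≡0)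
    ... | ()

  -- Even and odd coefficients of S and S²

  private
    E = u · v
    S = schur N
    ū = neg u
    v̄ = neg v
    uū≈1 : ∀ {M} → u · ū ≈[ M ] 𝟏
    uū≈1 = oddRatios-neg 1 N refl
    vv̄≈1 : ∀ {M} → v · v̄ ≈[ M ] 𝟏
    vv̄≈1 = oddRatios-neg 3 N refl

  neg-schur : ∀ {M} → neg S ≈[ M ] ū · v
  neg-schur = begin
    neg S              ≈⟨ neg-cong (schur≈ N) ⟩
    neg (u · v̄)        ≈⟨ neg-· u v̄ ⟩
    ū · neg v̄          ≈⟨ ·-congˡ ū (neg-involutive v) ⟩
    ū · v              ∎

  -- S(-q) = v/u, so the left side, twice the even part of S, is (u² + v²)/(uv), and
  -- `mixed-equation` cancels the denominator.
  even-part : S ⊕ neg S ≈[ N ] dil E ⊕ dil E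
  even-part = begin
    S ⊕ neg S                                          ≈⟨ ⊕-cong (schur≈ N) neg-schur ⟩
    u · v̄ ⊕ ū · v                                      ≈⟨ ⊕-cong (·-identityˡ (u · v̄)) (·-identityˡ (ū · v)) ⟨
    -- Both fractions are put over the common denominator u v: the factor 1 becomes u ū in the first
    -- and v v̄ in the second.
    𝟏 · (u · v̄) ⊕ 𝟏 · (ū · v)                          ≈⟨ ⊕-cong (·-congʳ (u · v̄) uū≈1) (·-congʳ (ū · v) vv̄≈1) ⟨
    u · ū · (u · v̄) ⊕ v · v̄ · (ū · v)
      ≈⟨ solve 4 (λ u v ū v̄ → u :* ū :* (u :* v̄) :+ v :* v̄ :* (ū :* v) := ū :* v̄ :* (u :* u :+ v :* v))
           ≈-refl u v ū v̄ ⟩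
    ū · v̄ · (u · u ⊕ v · v)                            ≈⟨ ·-congˡ (ū · v̄) mixed-equation ⟩
    ū · v̄ · (const (+ 2) · (u · dil u · (v · dil v)))
      ≈⟨ solve 6 (λ u v ū v̄ u′ v′ → ū :* v̄ :* (con (+ 2) :* (u :* u′ :* (v :* v′)))
                                 := con (+ 2) :* (u :* ū :* (v :* v̄) :* (u′ :* v′))) ≈-refl u v ū v̄ (dil u) (dil v) ⟩
    const (+ 2) · (u · ū · (v · v̄) · (dil u · dil v))
      ≈⟨ ·-congˡ (const (+ 2)) (·-cong (·-cong uū≈1 vv̄≈1) (≈-sym (dil-· u v))) ⟩
    const (+ 2) · (𝟏 · 𝟏 · dil E)
      ≈⟨ solve 1 (λ e → con (+ 2) :* (con (+ 1) :* con (+ 1) :* e) := e :+ e) ≈-refl (dil E) ⟩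
    dil E ⊕ dil E ∎

  -- The modular equation divided by u²v². Since S(-q) = 1/S and E(-q) = 1/E, both sides are
  -- differences f(q) - f(-q), which retain only odd coefficients.
  odd-part : ∀ {M} → N ≡ suc M → S · S ⊕ ⊖ neg (S · S) ≈[ M ] const (+ 2) · (E ⊕ ⊖ neg E)
  odd-part N≡ = begin
    S · S ⊕ ⊖ neg (S · S)
      ≈⟨ ⊕-cong (·-cong (schur≈ N) (schur≈ N))
           (⊖-cong (≈-trans (neg-· S S) (·-cong neg-schur neg-schur))) ⟩
    u · v̄ · (u · v̄) ⊕ ⊖ (ū · v · (ū · v))
      ≈⟨ solve 4 (λ u v ū v̄ → let o = con (+ 1) in
           u :* v̄ :* (u :* v̄) :+ :- (ū :* v :* (ū :* v))
           := o :* o :* (u :* v̄ :* (u :* v̄)) :+ :- (o :* o :* (ū :* v :* (ū :* v)))) ≈-refl u v ū v̄ ⟩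
    𝟏 · 𝟏 · (u · v̄ · (u · v̄)) ⊕ ⊖ (𝟏 · 𝟏 · (ū · v · (ū · v)))
      ≈⟨ ⊕-cong (·-congʳ (u · v̄ · (u · v̄)) (·-cong uū≈1 uū≈1))
           (⊖-cong (·-congʳ (ū · v · (ū · v)) (·-cong vv̄≈1 vv̄≈1))) ⟨
    u · ū · (u · ū) · (u · v̄ · (u · v̄)) ⊕ ⊖ (v · v̄ · (v · v̄) · (ū · v · (ū · v)))
      ≈⟨ solve 4 (λ u v ū v̄ →
           u :* ū :* (u :* ū) :* (u :* v̄ :* (u :* v̄)) :+ :- (v :* v̄ :* (v :* v̄) :* (ū :* v :* (ū :* v)))
           := ū :* v̄ :* (ū :* v̄) :* (u :* u :* (u :* u) :+ :- (v :* v :* (v :* v)))) ≈-refl u v ū v̄ ⟩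
    ū · v̄ · (ū · v̄) · lhs
      ≈⟨ ·-congˡ (ū · v̄ · (ū · v̄)) (modular-equation N≡) ⟩
    ū · v̄ · (ū · v̄) · rhs
      ≈⟨ solve 4 (λ u v ū v̄ → let o = con (+ 1); a = u :* ū; b = v :* v̄ in
           ū :* v̄ :* (ū :* v̄) :* (con (+ 2) :* (u :* v) :* (u :* u :* (v :* v) :+ :- o))
           := con (+ 2) :* (a :* b :* (a :* b) :* (u :* v) :+ :- (a :* b :* (ū :* v̄)))) ≈-refl u v ū v̄ ⟩
    const (+ 2) · (u · ū · (v · v̄) · (u · ū · (v · v̄)) · E ⊕ ⊖ (u · ū · (v · v̄) · (ū · v̄)))
      ≈⟨ ·-congˡ (const (+ 2)) (⊕-cong
           (·-congʳ E (·-cong (·-cong uū≈1 vv̄≈1) (·-cong uū≈1 vv̄≈1)))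
           (⊖-cong (·-cong (·-cong uū≈1 vv̄≈1) (≈-sym (neg-· u v))))) ⟩
    const (+ 2) · (𝟏 · 𝟏 · (𝟏 · 𝟏) · E ⊕ ⊖ (𝟏 · 𝟏 · neg E))
      ≈⟨ solve 2 (λ e ē → let o = con (+ 1) in
           con (+ 2) :* (o :* o :* (o :* o) :* e :+ :- (o :* o :* ē)) := con (+ 2) :* (e :+ :- ē)) ≈-refl E (neg E) ⟩
    const (+ 2) · (E ⊕ ⊖ neg E) ∎

  schur-even : ∀ m → m + m ≤ N → S (m + m) ≡ E m
  schur-even m 2m≤N = double-injective (begin≡
    S (m + m) +ℤ S (m + m)
      ≡⟨ cong (S (m + m) +ℤ_) (trans (cong (_*ℤ S (m + m)) even) (ℤₚ.*-identityˡ _)) ⟨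
    S (m + m) +ℤ neg S (m + m)              ≡⟨ ⊕-coeff S (neg S) (m + m) ⟨
    (S ⊕ neg S) (m + m)                     ≡⟨ even-part .at 2m≤N ⟩
    (dil E ⊕ dil E) (m + m)                 ≡⟨ ⊕-coeff (dil E) (dil E) (m + m) ⟩
    dil E (m + m) +ℤ dil E (m + m)          ≡⟨ cong₂ _+ℤ_ (dil-even E m) (dil-even E m) ⟩
    E m +ℤ E m                              ∎≡)
    where
    even : sign (m + m) ≡ + 1
    even = trans (sign-+ m m) (sign-sq m)

  schur²-odd : ∀ {M} → N ≡ suc M → ∀ m → m ≤ M → sign m ≡ - + 1 → (S · S) m ≡ + 2 *ℤ E m
  schur²-odd N≡ m m≤M odd = double-injective (begin≡
    (S · S) m +ℤ (S · S) m                  ≡⟨ odd-coeff (S · S) ⟨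
    (S · S ⊕ ⊖ neg (S · S)) m               ≡⟨ odd-part N≡ .at m≤M ⟩
    (const (+ 2) · (E ⊕ ⊖ neg E)) m         ≡⟨ const-· (+ 2) (E ⊕ ⊖ neg E) m ⟩
    + 2 *ℤ (E ⊕ ⊖ neg E) m                  ≡⟨ cong (+ 2 *ℤ_) (odd-coeff E) ⟩
    + 2 *ℤ (E m +ℤ E m)                     ≡⟨ ℤₚ.*-distribˡ-+ (+ 2) (E m) (E m) ⟩
    + 2 *ℤ E m +ℤ + 2 *ℤ E m                ∎≡)
    where
    minus-minus : ∀ a → - (- + 1 *ℤ a) ≡ a
    minus-minus = ℤ-solve-∀
    odd-coeff : ∀ f → (f ⊕ ⊖ neg f) m ≡ f m +ℤ f m
    odd-coeff f = trans (⊕-coeff f (⊖ neg f) m) (cong (f m +ℤ_) (trans (⊖-coeff (neg f) m)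
      (trans (cong (λ z → - (z *ℤ f m)) odd) (minus-minus (f m)))))

S3bar-odd : ∀ m → sign m ≡ - + 1 → S3bar^ 2 m ≡ + 2 *ℤ S3bar (m + m)
S3bar-odd m odd = begin≡
  S3bar^ 2 m                                ≡⟨ prodTo₂ (suc m) .at (ℕₚ.≤-refl {m}) ⟩
  (schur (suc m) · schur (suc m)) m         ≡⟨ ·-cong stable stable .at (ℕₚ.≤-refl {m}) ⟨
  (schur N · schur N) m                     ≡⟨ schur²-odd N refl m (ℕₚ.m≤m+n m m) odd ⟩
  + 2 *ℤ (oddRatios 1 N · oddRatios 3 N) m  ≡⟨ cong (+ 2 *ℤ_) (schur-even N m (ℕₚ.n≤1+n (m + m))) ⟨
  + 2 *ℤ schur N (m + m)                    ≡⟨ cong (+ 2 *ℤ_) (prodTo₁ N .at (ℕₚ.≤-refl {m + m})) ⟨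
  + 2 *ℤ S3bar (m + m)                      ∎≡
  where
  -- The number of factors in the definition of `S3bar (m + m)`, so that side matches exactly. The
  -- square is defined with `suc m` factors, and `stable` bridges the gap.
  N = suc (m + m)
  stable : schur N ≈[ m ] schur (suc m)
  stable = schur-stable (ℕₚ.≤-trans (ℕₚ.n≤1+n m) (ℕₚ.m≤n*m (suc m) 2)) (s≤s (ℕₚ.m≤m+n m m))

theorem4p3 : (n : ℕ) → S3bar^ 2 (2 * n + 1) ≡ + 2 *ℤ S3bar (4 * n + 2)
theorem4p3 n = trans (S3bar-odd (2 * n + 1) odd) (cong (λ k → + 2 *ℤ S3bar k) (double n))
  where
  odd : sign (2 * n + 1) ≡ - + 1
  odd = trans (sign-+ (2 * n) 1) (cong (_*ℤ - + 1) (sign-* 2 n refl))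
  double : ∀ n → 2 * n + 1 + (2 * n + 1) ≡ 4 * n + 2
  double = ℕ-Solver.solve-∀
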